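{- Every simple E-flat formula is equisatisfiable with a finite disjunction of permutation-invariant formulae of the form $$\exists\underline z.\;\alpha(\underline y,\underline z)\wedge\sharp\{x\mid\beta_1(\mathbf a(x),\underline y,\underline z)\}=z_1\wedge\cdots\wedge\sharp\{x\mid\beta_K(\mathbf a(x),\underline y,\underline z)\}=z_K,$$ where $\alpha(\underline y,\underline z)$ is an arithmetic formula and each $\beta_l(\mathbf a(x),\underline y,\underline z)$ is a basic formula obtained from an arithmetic formula $\beta_l(\underline u,\underline y,\underline z)$ (not containing $x$) by replacing the variables $\underline u=u_1,\dots,u_s$ by $a_1(x),\dots,a_s(x)$.
   Context: Logic: Presburger arithmetic over $\mathbb Z$ extended with free unary function symbols (array-ids) and cardinality terms. Terms: numerals, parameters (free constants, including a distinguished parameter $N$), individual variables, $t+t$, $-t$, $a(t)$ for an array-id $a$, and $\sharp\{x\mid\phi\}$. Atoms: $t<t$, $t=t$, $t\equiv_n t$. Formulae are built from atoms by $\wedge,\neg,\exists x$. Semantics: over the integers; each array-id $a$ is a function $\mathbb Z\to\mathbb Z$ with $a(x)=0$ for $x\notin[0,N)$; $\sharp\{x\mid\phi\}$ is the cardinality of the set of $x\in[0,N)$ satisfying $\phi(x)$ (it binds $x$). Satisfiability means some assignment to parameters, free variables and array-ids (respecting these conventions) makes the formula true; two formulae are equisatisfiable if one is satisfiable iff the other is. An arithmetic formula contains neither array-ids nor $\sharp$. A basic formula is obtained from an arithmetic formula by simultaneously replacing some free variables by terms $a(y)$, $y$ a variable, $a$ an array-id; for a tuple $\mathbf a=a_1,\dots,a_s$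 of array-ids and a tuple of variables $\underline y$, $\mathbf a(\underline y)$ denotes all terms $a_i(y_j)$. A simple E-flat formula is a formula of the form $\exists\underline z.\,\alpha(\mathbf a(\underline y),\mathbf a(\underline z),\underline y,\underline z)\wedge\bigwedge_{l=1}^K\sharp\{x\mid\beta_l(\mathbf a(x),\mathbf a(\underline y),\mathbf a(\underline z),\underline y,\underline z)\}=z_l$ with $\underline z=z_1,\dots,z_K$, where $\alpha$ and the $\beta_l$ are basic formulae, $x$ does not occur in $\alpha$, and in each $\beta_l$ the variable $x$ occurs only inside terms $a(x)$ (never outside an array read). A formula is permutation-invariant if its truth value under an assignment is unchanged when, for an arbitrary permutation $\pi$ of $[0,N)$, every array-id $a$ is simultaneously reinterpreted as $i\mapsto a(\pi(i))$ on $[0,N)$ (and $0$ outside). -}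

module Defs where

open import Data.Nat as ℕ using (ℕ; suc)
open import Data.Integer as ℤ using (ℤ; +_; 0ℤ; _+_; -_; _-_; _<_; _≤_)
open import Data.Integer.Divisibility using (_∣_)
open import Data.List using (List; []; _∷_; map; length)
open import Data.List.Membership.Propositional using (_∈_; _∉_)
open import Data.List.Relation.Unary.All using (All)
open import Data.List.Relation.Unary.Unique.Propositional using (Unique)
open import Data.Product using (Σ; _×_; _,_; proj₁; proj₂)
open import Data.Unit using (⊤)
open import Data.Empty using (⊥; ⊥-elim)
open import Relation.Nullary using (¬_; Dec; yes; no)
open import Relation.Nullary.Decidable using (_×-dec_)
open import Relation.Binary.PropositionalEquality using (_≡_; _≢_; refl)

Var : Set
Var = ℕ

ParamId : Set
ParamId = ℕ

ArrayId : Set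
ArrayId = ℕ

mutual
  data Term : Set where
    num  : ℤ → Term
    par  : ParamId → Term
    parN : Term
    var  : Var → Term
    _⊕_  : Term → Term → Term
    ⊖_   : Term → Term
    rd   : ArrayId → Term → Term
    ♯    : Var → Form → Term

  data Form : Set where
    _≺_  : Term → Term → Form
    _≐_  : Term → Term → Form
    cng  : ℕ → Term → Term → Form   -- cng n t u  means  t ≡ u (mod n+1)
    _∧_  : Form → Form → Form
    ¬'   : Form → Form
    ∃'   : Var → Form → Form

InRange : ℤ → ℤ → Set
InRange N i = (0ℤ ≤ i) × (i < N)

inRange? : (N i : ℤ) → Dec (InRange N i)
inRange? N i = (0ℤ ℤ.≤? i) ×-dec (i ℤ.<? N)

record Model : Set where
  field
    N        : ℤ
    param    : ParamId → ℤ
    arr      : ArrayId → ℤ → ℤ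
    arr-zero : ∀ a i → ¬ InRange N i → arr a i ≡ 0ℤ

open Model public

Env : Set
Env = Var → ℤ

_[_↦_] : Env → Var → ℤ → Env
(ρ [ x ↦ v ]) y with y ℕ.≟ x
... | yes _ = v
... | no  _ = ρ y

IsCard : ℤ → (ℤ → Set) → ℤ → Set
IsCard N P c =
  Σ (List ℤ) λ xs →
    Unique xs × All (λ i → InRange N i × P i) xs
    × (∀ i → InRange N i → P i → i ∈ xs) × (c ≡ + length xs)

mutual
  Val : Model → Env → Term → ℤ → Set
  Val M ρ (num n) v = v ≡ n
  Val M ρ (par p) v = v ≡ param M p
  Val M ρ parN v = v ≡ N M
  Val M ρ (var x) v = v ≡ ρ x
  Val M ρ (t ⊕ u) v = Σ ℤ λ a → Σ ℤ λ b → Val M ρ t a × Val M ρ u b × (v ≡ a + b)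
  Val M ρ (⊖ t) v = Σ ℤ λ a → Val M ρ t a × (v ≡ - a)
  Val M ρ (rd a t) v = Σ ℤ λ i → Val M ρ t i × (v ≡ arr M a i)
  Val M ρ (♯ x φ) v = IsCard (N M) (λ i → Sem M (ρ [ x ↦ i ]) φ) v

  Sem : Model → Env → Form → Set
  Sem M ρ (t ≺ u) = Σ ℤ λ a → Σ ℤ λ b → Val M ρ t a × Val M ρ u b × (a < b)
  Sem M ρ (t ≐ u) = Σ ℤ λ a → Σ ℤ λ b → Val M ρ t a × Val M ρ u b × (a ≡ b)
  Sem M ρ (cng n t u) = Σ ℤ λ a → Σ ℤ λ b → Val M ρ t a × Val M ρ u b × ((+ suc n) ∣ (a - b))
  Sem M ρ (φ ∧ ψ) = Sem M ρ φ × Sem M ρ ψ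
  Sem M ρ (¬' φ) = ¬ Sem M ρ φ
  Sem M ρ (∃' x φ) = Σ ℤ λ v → Sem M (ρ [ x ↦ v ]) φ

Sat : Form → Set
Sat φ = Σ Model λ M → Σ Env λ ρ → Sem M ρ φ

-- equisatisfiability (classical notion, read through double negation)
Equisat : Form → Form → Set
Equisat φ ψ = (¬ ¬ Sat φ → ¬ ¬ Sat ψ) × (¬ ¬ Sat ψ → ¬ ¬ Sat φ)

record Perm (N : ℤ) : Set where
  field
    f    : ℤ → ℤ
    g    : ℤ → ℤ
    f-in : ∀ i → InRange N i → InRange N (f i)
    g-in : ∀ i → InRange N i → InRange N (g i)
    g∘f  : ∀ i → InRange N i → g (f i) ≡ i
    f∘g  : ∀ i → InRange N i → f (g i) ≡ i

permArr : (N : ℤ) → Perm N → (ArrayId → ℤ → ℤ) → ArrayId → ℤ → ℤ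
permArr N π ar a i with inRange? N i
... | yes _ = ar a (Perm.f π i)
... | no  _ = 0ℤ

permArr-zero : ∀ N (π : Perm N) ar a i → ¬ InRange N i → permArr N π ar a i ≡ 0ℤ
permArr-zero N π ar a i ¬r with inRange? N i
... | yes r = ⊥-elim (¬r r)
... | no  _ = refl

permute : (M : Model) → Perm (N M) → Model
permute M π = record
  { N = N M ; param = param M ; arr = permArr (N M) π (arr M)
  ; arr-zero = permArr-zero (N M) π (arr M) }

PermInvariant : Form → Set
PermInvariant φ = ∀ (M : Model) (π : Perm (N M)) (ρ : Env) →
  (Sem M ρ φ → Sem (permute M π) ρ φ) × (Sem (permute M π) ρ φ → Sem M ρ φ)

mutual
  ArithT : Term → Set
  ArithT (num _) = ⊤
  ArithT (par _) = ⊤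
  ArithT parN = ⊤
  ArithT (var _) = ⊤
  ArithT (t ⊕ u) = ArithT t × ArithT u
  ArithT (⊖ t) = ArithT t
  ArithT (rd _ _) = ⊥
  ArithT (♯ _ _) = ⊥

  Arith : Form → Set
  Arith (t ≺ u) = ArithT t × ArithT u
  Arith (t ≐ u) = ArithT t × ArithT u
  Arith (cng _ t u) = ArithT t × ArithT u
  Arith (φ ∧ ψ) = Arith φ × Arith ψ
  Arith (¬' φ) = Arith φ
  Arith (∃' _ φ) = Arith φ

-- basic: arithmetic except for reads a(y) with y a variable not bound
-- at that position (i.e. obtained by replacing free variables of an
-- arithmetic formula by terms a(y), capture-avoidingly).
-- B = variables bound by enclosing quantifiers.
mutual
  BasicT : List Var → Term → Set
  BasicT B (num _) = ⊤
  BasicT B (par _) = ⊤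
  BasicT B parN = ⊤
  BasicT B (var _) = ⊤
  BasicT B (t ⊕ u) = BasicT B t × BasicT B u
  BasicT B (⊖ t) = BasicT B t
  BasicT B (rd _ (var y)) = y ∉ B
  BasicT B (rd _ _) = ⊥
  BasicT B (♯ _ _) = ⊥

  BasicF : List Var → Form → Set
  BasicF B (t ≺ u) = BasicT B t × BasicT B u
  BasicF B (t ≐ u) = BasicT B t × BasicT B u
  BasicF B (cng _ t u) = BasicT B t × BasicT B u
  BasicF B (φ ∧ ψ) = BasicF B φ × BasicF B ψ
  BasicF B (¬' φ) = BasicF B φ
  BasicF B (∃' y φ) = BasicF (y ∷ B) φ

Basic : Form → Set
Basic = BasicF []

mutual
  NotOccT : Var → Term → Set
  NotOccT x (num _) = ⊤
  NotOccT x (par _) = ⊤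
  NotOccT x parN = ⊤
  NotOccT x (var y) = y ≢ x
  NotOccT x (t ⊕ u) = NotOccT x t × NotOccT x u
  NotOccT x (⊖ t) = NotOccT x t
  NotOccT x (rd _ t) = NotOccT x t
  NotOccT x (♯ y φ) = (y ≢ x) × NotOcc x φ

  NotOcc : Var → Form → Set
  NotOcc x (t ≺ u) = NotOccT x t × NotOccT x u
  NotOcc x (t ≐ u) = NotOccT x t × NotOccT x u
  NotOcc x (cng _ t u) = NotOccT x t × NotOccT x u
  NotOcc x (φ ∧ ψ) = NotOcc x φ × NotOcc x ψ
  NotOcc x (¬' φ) = NotOcc x φ
  NotOcc x (∃' y φ) = (y ≢ x) × NotOcc x φ

mutual
  OnlyInReadsT : Var → Term → Set
  OnlyInReadsT x (num _) = ⊤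
  OnlyInReadsT x (par _) = ⊤
  OnlyInReadsT x parN = ⊤
  OnlyInReadsT x (var y) = y ≢ x
  OnlyInReadsT x (t ⊕ u) = OnlyInReadsT x t × OnlyInReadsT x u
  OnlyInReadsT x (⊖ t) = OnlyInReadsT x t
  OnlyInReadsT x (rd _ (var _)) = ⊤
  OnlyInReadsT x (rd _ t) = OnlyInReadsT x t
  OnlyInReadsT x (♯ y φ) = (y ≢ x) × OnlyInReads x φ

  OnlyInReads : Var → Form → Set
  OnlyInReads x (t ≺ u) = OnlyInReadsT x t × OnlyInReadsT x u
  OnlyInReads x (t ≐ u) = OnlyInReadsT x t × OnlyInReadsT x u
  OnlyInReads x (cng _ t u) = OnlyInReadsT x t × OnlyInReadsT x u
  OnlyInReads x (φ ∧ ψ) = OnlyInReads x φ × OnlyInReads x ψ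
  OnlyInReads x (¬' φ) = OnlyInReads x φ
  OnlyInReads x (∃' y φ) = (y ≢ x) × OnlyInReads x φ

-- β(a(x), y, z): obtained from an arithmetic β(u, y, z) not containing x
-- by replacing u₁..uₛ by a₁(x)..aₛ(x): the only array reads are a(x),
-- there are no cardinality terms, and x occurs nowhere else.
mutual
  ReadsAtT : Var → Term → Set
  ReadsAtT x (num _) = ⊤
  ReadsAtT x (par _) = ⊤
  ReadsAtT x parN = ⊤
  ReadsAtT x (var y) = y ≢ x
  ReadsAtT x (t ⊕ u) = ReadsAtT x t × ReadsAtT x u
  ReadsAtT x (⊖ t) = ReadsAtT x t
  ReadsAtT x (rd _ (var y)) = y ≡ x
  ReadsAtT x (rd _ _) = ⊥
  ReadsAtT x (♯ _ _) = ⊥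

  ReadsAt : Var → Form → Set
  ReadsAt x (t ≺ u) = ReadsAtT x t × ReadsAtT x u
  ReadsAt x (t ≐ u) = ReadsAtT x t × ReadsAtT x u
  ReadsAt x (cng _ t u) = ReadsAtT x t × ReadsAtT x u
  ReadsAt x (φ ∧ ψ) = ReadsAt x φ × ReadsAt x ψ
  ReadsAt x (¬' φ) = ReadsAt x φ
  ReadsAt x (∃' y φ) = (y ≢ x) × ReadsAt x φ

exs : List Var → Form → Form
exs [] φ = φ
exs (z ∷ zs) φ = ∃' z (exs zs φ)

conjs : Form → List Form → Form
conjs φ [] = φ
conjs φ (c ∷ cs) = conjs (φ ∧ c) cs

cardEq : Var → Form × Var → Form
cardEq x (β , z) = ♯ x β ≐ var z

flatForm : Var → Form → List (Form × Var) → Form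
flatForm x α cs = exs (map proj₂ cs) (conjs α (map (cardEq x) cs))

SimpleEFlat : Form → Set
SimpleEFlat φ =
  Σ Var λ x → Σ Form λ α → Σ (List (Form × Var)) λ cs →
    (φ ≡ flatForm x α cs)
    × Unique (map proj₂ cs) × (x ∉ map proj₂ cs)
    × Basic α × NotOcc x α
    × All (λ c → Basic (proj₁ c) × OnlyInReads x (proj₁ c)) cs

TargetForm : Form → Set
TargetForm ψ =
  Σ Var λ x → Σ Form λ α → Σ (List (Form × Var)) λ cs →
    (ψ ≡ flatForm x α cs)
    × Unique (map proj₂ cs) × (x ∉ map proj₂ cs)
    × Arith α × NotOcc x α
    × All (λ c → ReadsAt x (proj₁ c)) cs

⋁ : List Form → Form
⋁ [] = num 0ℤ ≺ num 0ℤ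
⋁ (ψ ∷ ψs) = ¬' (¬' ψ ∧ ¬' (⋁ ψs))

-- Every read a(r) of a free index r ≠ x is replaced by a fresh "shadow" variable w_{a,r}, and for
-- every such r a new counter c_r = ♯{x | a(x) = w_{·,r} for all a} is added. The resulting formula
-- only reads arrays at the counting variable x, hence is invariant under permutations of [0,N).
-- An arithmetic side condition records what the shadows must satisfy to be realisable as actual
-- reads: indices outside [0,N) have zero shadows, equal indices have equal shadows, and (Hall's
-- condition) c_h exceeds the number of other distinct in-range indices sharing h's shadow tuple.
-- Conversely, given a model of the new formula, Hall's condition lets one place the indices one
-- at a time by transpositions of array positions, until every free read a(r) equals w_{a,r}.
-- So a single permutation-invariant disjunct suffices.
module Submission where

open import Defs
open import Data.Nat as ℕ using (ℕ; suc; _⊔_; _∸_; z≤n; s≤s)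
  renaming (_<_ to _<ℕ_; _≤_ to _≤ℕ_; _+_ to _+ℕ_; _*_ to _*ℕ_)
import Data.Nat.Properties as ℕP
open import Data.Nat.DivMod using (_%_; _/_; [m+kn]%n≡m%n; m<n⇒m%n≡m; +-distrib-/; m<n⇒m/n≡0; m*n/n≡m; m*n%n≡0)
open import Data.Integer as ℤ using (ℤ; +_; -[1+_]; 0ℤ; _<_; _≤_; +<+; +≤+)
import Data.Integer.Properties as ℤP
open import Data.List using (List; []; _∷_; map; length; _++_; filter; downFrom)
open import Data.List.Properties using (length-map; map-++; map-∘)
open import Data.List.Membership.Propositional using (_∈_; _∉_; find)
open import Data.List.Membership.Propositional.Properties
  using (∈-map⁺; ∈-map⁻; ∈-++⁺ˡ; ∈-++⁺ʳ; ∈-++⁻; ∈-filter⁺; ∈-filter⁻; ∈-downFrom⁺; ∈-downFrom⁻)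
import Data.List.Membership.DecPropositional as DecMembership
open import Data.List.Relation.Unary.Any using (here; there)
open import Data.List.Relation.Unary.All as All using (All; []; _∷_)
import Data.List.Relation.Unary.All.Properties as AllP
open import Data.List.Relation.Unary.AllPairs using (AllPairs; []; _∷_)
open import Data.List.Relation.Unary.Unique.Propositional using (Unique)
import Data.List.Relation.Unary.Unique.Propositional.Properties as UniqueP
open import Data.List.Relation.Binary.Sublist.Propositional using ([]; _∷_; _∷ʳ_; ⊆-refl; ⊆-trans)
  renaming (_⊆_ to _⊑_; lookup to ⊑-lookup)
open import Data.List.Relation.Binary.Sublist.Propositional.Properties using (filter-⊆) renaming (map⁺ to ⊑-map⁺)
open import Data.Product using (Σ; ∃; _×_; _,_; proj₁; proj₂)
open import Data.Sum using (_⊎_; inj₁; inj₂)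
open import Data.Unit using (⊤; tt)
open import Data.Empty using (⊥; ⊥-elim)
open import Function using (_∘_)
open import Relation.Nullary using (¬_; Dec; yes; no; ¬?)
open import Relation.Nullary.Decidable using (decidable-stable; map′)
open import Relation.Binary.PropositionalEquality
  using (_≡_; _≢_; refl; sym; trans; cong; cong₂; subst; module ≡-Reasoning)

_⇔_ : Set → Set → Set
A ⇔ B = (A → B) × (B → A)

⇔-refl : ∀ {A : Set} → A ⇔ A
⇔-refl = (λ a → a) , (λ a → a)

⇔-sym : ∀ {A B : Set} → A ⇔ B → B ⇔ A
⇔-sym (A→B , B→A) = B→A , A→B

⇔-trans : ∀ {A B C : Set} → A ⇔ B → B ⇔ C → A ⇔ C
⇔-trans (A→B , B→A) (B→C , C→B) = B→C ∘ A→B , B→A ∘ C→B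

_×-⇔_ : ∀ {A A' B B' : Set} → A ⇔ A' → B ⇔ B' → (A × B) ⇔ (A' × B')
(A→A' , A'→A) ×-⇔ (B→B' , B'→B) = (λ (a , b) → A→A' a , B→B' b) , (λ (a , b) → A'→A a , B'→B b)

¬-⇔ : ∀ {A B : Set} → A ⇔ B → (¬ A) ⇔ (¬ B)
¬-⇔ (A→B , B→A) = (λ ¬a b → ¬a (B→A b)) , (λ ¬b a → ¬b (A→B a))

Σ-⇔ : ∀ {A B : ℤ → Set} → (∀ {v} → A v ⇔ B v) → Σ ℤ A ⇔ Σ ℤ B
Σ-⇔ A⇔B = (λ (v , a) → v , proj₁ A⇔B a) , (λ (v , b) → v , proj₂ A⇔B b)

binary-map : ∀ {A A' B B' : ℤ → Set} {R : ℤ → ℤ → Set} → (∀ {v} → A v → A' v) → (∀ {v} → B v → B' v) →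
             (Σ ℤ λ a → Σ ℤ λ b → A a × B b × R a b) → (Σ ℤ λ a → Σ ℤ λ b → A' a × B' b × R a b)
binary-map f g (a , b , p , q , r) = a , b , f p , g q , r

binary-⇔ : ∀ {A A' B B' : ℤ → Set} {R : ℤ → ℤ → Set} → (∀ {v} → A v ⇔ A' v) → (∀ {v} → B v ⇔ B' v) →
           (Σ ℤ λ a → Σ ℤ λ b → A a × B b × R a b) ⇔ (Σ ℤ λ a → Σ ℤ λ b → A' a × B' b × R a b)
binary-⇔ A⇔A' B⇔B' = binary-map (proj₁ A⇔A') (proj₁ B⇔B') , binary-map (proj₂ A⇔A') (proj₂ B⇔B')

_∈ℕ?_ : (y : ℕ) (ys : List ℕ) → Dec (y ∈ ys)
_∈ℕ?_ = DecMembership._∈?_ ℕ._≟_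

_∈ℤ?_ : (i : ℤ) (is : List ℤ) → Dec (i ∈ is)
_∈ℤ?_ = DecMembership._∈?_ ℤP._≟_

remove : ∀ {A : Set} {x : A} (ys : List A) → x ∈ ys → List A
remove (y ∷ ys) (here _) = ys
remove (y ∷ ys) (there x∈ys) = y ∷ remove ys x∈ys

length-remove : ∀ {A : Set} {x : A} ys (x∈ys : x ∈ ys) → suc (length (remove ys x∈ys)) ≡ length ys
length-remove (y ∷ ys) (here _) = refl
length-remove (y ∷ ys) (there x∈ys) = cong suc (length-remove ys x∈ys)

∈-remove : ∀ {A : Set} {x z : A} ys (x∈ys : x ∈ ys) → z ∈ ys → z ≢ x → z ∈ remove ys x∈ys
∈-remove (y ∷ ys) (here refl) (here refl) z≢x = ⊥-elim (z≢x refl)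
∈-remove (y ∷ ys) (here _) (there z∈ys) _ = z∈ys
∈-remove (y ∷ ys) (there x∈ys) (here z≡y) _ = here z≡y
∈-remove (y ∷ ys) (there x∈ys) (there z∈ys) z≢x = there (∈-remove ys x∈ys z∈ys z≢x)

Unique-⊆⇒length≤ : ∀ {A : Set} (xs ys : List A) → Unique xs → All (_∈ ys) xs → length xs ≤ℕ length ys
Unique-⊆⇒length≤ [] ys _ _ = z≤n
Unique-⊆⇒length≤ (x ∷ xs) ys (x∉xs ∷ u) (x∈ys ∷ xs⊆ys) =
  subst (suc (length xs) ≤ℕ_) (length-remove ys x∈ys)
    (s≤s (Unique-⊆⇒length≤ xs (remove ys x∈ys) u
      (All.zipWith (λ (z∈ys , x≢z) → ∈-remove ys x∈ys z∈ys (x≢z ∘ sym)) (xs⊆ys , x∉xs))))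

Unique-map-injectiveOn : ∀ {A B : Set} {Q : A → Set} {g : A → B} {xs} →
  (∀ {i j} → Q i → Q j → g i ≡ g j → i ≡ j) → All Q xs → Unique xs → Unique (map g xs)
Unique-map-injectiveOn inj [] [] = []
Unique-map-injectiveOn inj (q ∷ qs) (x∉ ∷ u) =
  AllP.map⁺ (All.zipWith (λ (q' , x≢y) gx≡gy → x≢y (inj q q' gx≡gy)) (qs , x∉)) ∷ Unique-map-injectiveOn inj qs u

AllPairs-anti-mono : ∀ {A : Set} {R : A → A → Set} {xs ys : List A} → xs ⊑ ys → AllPairs R ys → AllPairs R xs
AllPairs-anti-mono [] [] = []
AllPairs-anti-mono (_ ∷ʳ xs⊑ys) (_ ∷ rys) = AllPairs-anti-mono xs⊑ys rys
AllPairs-anti-mono (refl ∷ xs⊑ys) (ry ∷ rys) = AllP.anti-mono (⊑-lookup xs⊑ys) ry ∷ AllPairs-anti-mono xs⊑ys rys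

subsequences : ∀ {A : Set} → List A → List (List A)
subsequences [] = [] ∷ []
subsequences (y ∷ ys) = map (y ∷_) (subsequences ys) ++ subsequences ys

∈-subsequences⁺ : ∀ {A : Set} {xs ys : List A} → xs ⊑ ys → xs ∈ subsequences ys
∈-subsequences⁺ [] = here refl
∈-subsequences⁺ {ys = y ∷ ys} (_ ∷ʳ xs⊑ys) = ∈-++⁺ʳ (map (y ∷_) (subsequences ys)) (∈-subsequences⁺ xs⊑ys)
∈-subsequences⁺ (refl ∷ xs⊑ys) = ∈-++⁺ˡ (∈-map⁺ (_ ∷_) (∈-subsequences⁺ xs⊑ys))

∈-subsequences⁻ : ∀ {A : Set} {xs : List A} ys → xs ∈ subsequences ys → xs ⊑ ys
∈-subsequences⁻ [] (here refl) = []
∈-subsequences⁻ (y ∷ ys) xs∈ with ∈-++⁻ (map (y ∷_) (subsequences ys)) xs∈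
... | inj₂ xs∈' = y ∷ʳ ∈-subsequences⁻ ys xs∈'
... | inj₁ xs∈' with ∈-map⁻ (y ∷_) xs∈'
...   | _ , xs'∈ , refl = refl ∷ ∈-subsequences⁻ ys xs'∈

All-downFrom⁺ : ∀ {P : ℕ → Set} n → (∀ a → a <ℕ n → P a) → All P (downFrom n)
All-downFrom⁺ n p = All.tabulate (λ a∈ → p _ (∈-downFrom⁻ a∈))

All-downFrom⁻ : ∀ {P : ℕ → Set} {n} → All P (downFrom n) → ∀ a → a <ℕ n → P a
All-downFrom⁻ ps a a<n = All.lookup ps (∈-downFrom⁺ a<n)

All-⇔ : ∀ {A : Set} {P Q : A → Set} {xs} → All (λ a → P a ⇔ Q a) xs → All P xs ⇔ All Q xs
All-⇔ P⇔Q = (λ ps → All.zipWith (λ (e , p) → proj₁ e p) (P⇔Q , ps)) ,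
            (λ qs → All.zipWith (λ (e , q) → proj₂ e q) (P⇔Q , qs))

All-map-⇔ : ∀ {A B : Set} {P : B → Set} {f : A → B} xs → All P (map f xs) ⇔ All (P ∘ f) xs
All-map-⇔ _ = AllP.map⁻ , AllP.map⁺

All-++-⇔ : ∀ {A : Set} {P : A → Set} xs {ys} → All P (xs ++ ys) ⇔ (All P xs × All P ys)
All-++-⇔ xs = AllP.++⁻ xs , λ (ps , qs) → AllP.++⁺ ps qs

update-same : ∀ (ρ : Env) x v → (ρ [ x ↦ v ]) x ≡ v
update-same ρ x v with x ℕ.≟ x
... | yes _ = refl
... | no x≢x = ⊥-elim (x≢x refl)

update-other : ∀ (ρ : Env) x v {y} → y ≢ x → (ρ [ x ↦ v ]) y ≡ ρ y
update-other ρ x v {y} y≢x with y ℕ.≟ x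
... | yes y≡x = ⊥-elim (y≢x y≡x)
... | no _ = refl

override : Env → List Var → Env → Env
override ρ [] ν = ρ
override ρ (z ∷ zs) ν = override (ρ [ z ↦ ν z ]) zs ν

override-∉ : ∀ ρ zs ν {y} → y ∉ zs → override ρ zs ν y ≡ ρ y
override-∉ ρ [] ν _ = refl
override-∉ ρ (z ∷ zs) ν y∉ =
  trans (override-∉ _ zs ν (y∉ ∘ there)) (update-other ρ z (ν z) (y∉ ∘ here))

override-∈ : ∀ ρ zs ν {y} → y ∈ zs → override ρ zs ν y ≡ ν y
override-∈ ρ (z ∷ zs) ν {y} y∈ with y ∈ℕ? zs
... | yes y∈zs = override-∈ _ zs ν y∈zs
... | no y∉zs with y∈
...   | here refl = trans (override-∉ _ zs ν y∉zs) (update-same ρ z (ν z))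
...   | there y∈zs = ⊥-elim (y∉zs y∈zs)

-- Cardinalities and permutations

IsCard-cong : ∀ {N P Q c} → (∀ i → InRange N i → P i → Q i) → (∀ i → InRange N i → Q i → P i) →
              IsCard N P c → IsCard N Q c
IsCard-cong P⇒Q Q⇒P (xs , u , all , complete , c≡) =
  xs , u , All.map (λ (r , p) → r , P⇒Q _ r p) all , (λ i r q → complete i r (Q⇒P i r q)) , c≡

IsCard-⇔ : ∀ {N P Q c} → (∀ i → InRange N i → P i ⇔ Q i) → IsCard N P c ⇔ IsCard N Q c
IsCard-⇔ P⇔Q = IsCard-cong (λ i r → proj₁ (P⇔Q i r)) (λ i r → proj₂ (P⇔Q i r)) ,
               IsCard-cong (λ i r → proj₂ (P⇔Q i r)) (λ i r → proj₁ (P⇔Q i r))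

IsCard-exists : ∀ {P : ℤ → Set} → (∀ i → Dec (P i)) → ∀ N → Σ ℤ (IsCard N P)
IsCard-exists {P} P? (+ n) = + length xs , xs , unique , All.tabulate sound , complete , refl
  where
  xs = filter P? (map +_ (downFrom n))
  unique : Unique xs
  unique = UniqueP.filter⁺ P? (UniqueP.map⁺ ℤP.+-injective (UniqueP.downFrom⁺ n))
  sound : ∀ {i} → i ∈ xs → InRange (+ n) i × P i
  sound i∈ with ∈-filter⁻ P? {xs = map +_ (downFrom n)} i∈
  ... | i∈' , p with ∈-map⁻ +_ i∈'
  ...   | j , j∈ , refl = (+≤+ z≤n , +<+ (∈-downFrom⁻ j∈)) , p
  complete : ∀ i → InRange (+ n) i → P i → i ∈ xs
  complete (+ j) (_ , +<+ j<n) p = ∈-filter⁺ P? (∈-map⁺ +_ (∈-downFrom⁺ j<n)) p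
IsCard-exists P? -[1+ m ] = 0ℤ , [] , [] , [] , (λ i (0≤i , i<N) _ → ⊥-elim (empty (ℤP.≤-<-trans 0≤i i<N))) , refl
  where
  empty : ¬ (0ℤ < -[1+ m ])
  empty ()

length≤IsCard : ∀ {N P c} ys → IsCard N P c → Unique ys → All (λ i → InRange N i × P i) ys → + length ys ≤ c
length≤IsCard ys (xs , _ , _ , complete , refl) u all =
  +≤+ (Unique-⊆⇒length≤ ys xs u (All.map (λ (r , p) → complete _ r p) all))

IsCard-∃∉ : ∀ {N P c} ys → IsCard N P c → + length ys < c → ∃ λ i → InRange N i × P i × i ∉ ys
IsCard-∃∉ ys (xs , u , all , _ , refl) |ys|<c with All.all? (_∈ℤ? ys) xs
... | yes xs⊆ys = ⊥-elim (ℕP.<⇒≱ (ℤP.drop‿+<+ |ys|<c) (Unique-⊆⇒length≤ xs ys u xs⊆ys))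
... | no xs⊈ys with find (AllP.¬All⇒Any¬ (_∈ℤ? ys) xs xs⊈ys)
...   | i , i∈xs , i∉ys = i , proj₁ (All.lookup all i∈xs) , proj₂ (All.lookup all i∈xs) , i∉ys

Perm-inverse : ∀ {N} → Perm N → Perm N
Perm-inverse π = record
  { f = Perm.g π ; g = Perm.f π ; f-in = Perm.g-in π ; g-in = Perm.f-in π
  ; g∘f = Perm.f∘g π ; f∘g = Perm.g∘f π }

IsCard-perm : ∀ {N P c} (π : Perm N) → IsCard N P c → IsCard N (P ∘ Perm.f π) c
IsCard-perm {N} {P} π (xs , u , all , complete , c≡) =
  map g xs , Unique-map-injectiveOn g-injectiveOn (All.map proj₁ all) u ,
  AllP.map⁺ (All.map (λ {i} (r , p) → g-in i r , subst P (sym (f∘g i r)) p) all) ,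
  (λ i r p → subst (_∈ map g xs) (g∘f i r) (∈-map⁺ g (complete (f i) (f-in i r) p))) ,
  trans c≡ (cong +_ (sym (length-map g xs)))
  where
  open Perm π
  g-injectiveOn : ∀ {i j} → InRange N i → InRange N j → g i ≡ g j → i ≡ j
  g-injectiveOn {i} {j} ri rj gi≡gj = trans (sym (f∘g i ri)) (trans (cong f gi≡gj) (f∘g j rj))

permArr-inRange : ∀ N (π : Perm N) ar a i → InRange N i → permArr N π ar a i ≡ ar a (Perm.f π i)
permArr-inRange N π ar a i r with inRange? N i
... | yes _ = refl
... | no ¬r = ⊥-elim (¬r r)

module Transposition (N : ℤ) (p q : ℤ) (p∈ : InRange N p) (q∈ : InRange N q) where
  swap : ℤ → ℤ
  swap i with i ℤP.≟ p
  ... | yes _ = q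
  ... | no _ with i ℤP.≟ q
  ...   | yes _ = p
  ...   | no _ = i

  swap-p : swap p ≡ q
  swap-p with p ℤP.≟ p
  ... | yes _ = refl
  ... | no p≢p = ⊥-elim (p≢p refl)

  swap-q : swap q ≡ p
  swap-q with q ℤP.≟ p
  ... | yes q≡p = q≡p
  ... | no _ with q ℤP.≟ q
  ...   | yes _ = refl
  ...   | no q≢q = ⊥-elim (q≢q refl)

  swap-other : ∀ {i} → i ≢ p → i ≢ q → swap i ≡ i
  swap-other {i} i≢p i≢q with i ℤP.≟ p
  ... | yes i≡p = ⊥-elim (i≢p i≡p)
  ... | no _ with i ℤP.≟ q
  ...   | yes i≡q = ⊥-elim (i≢q i≡q)
  ...   | no _ = refl

  swap-involutive : ∀ i → swap (swap i) ≡ i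
  swap-involutive i with i ℤP.≟ p
  ... | yes refl = swap-q
  ... | no i≢p with i ℤP.≟ q
  ...   | yes refl = swap-p
  ...   | no i≢q = swap-other i≢p i≢q

  swap-inRange : ∀ i → InRange N i → InRange N (swap i)
  swap-inRange i i∈ with i ℤP.≟ p
  ... | yes _ = q∈
  ... | no _ with i ℤP.≟ q
  ...   | yes _ = p∈
  ...   | no _ = i∈

  transposition : Perm N
  transposition = record
    { f = swap ; g = swap ; f-in = swap-inRange ; g-in = swap-inRange
    ; g∘f = λ i _ → swap-involutive i ; f∘g = λ i _ → swap-involutive i }

exs-intro : ∀ {M} ρ zs ν φ → Sem M (override ρ zs ν) φ → Sem M ρ (exs zs φ)
exs-intro ρ [] ν φ s = s
exs-intro ρ (z ∷ zs) ν φ s = ν z , exs-intro (ρ [ z ↦ ν z ]) zs ν φ s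

exs-elim : ∀ {M} ρ zs φ → Sem M ρ (exs zs φ) → Σ Env λ ρ' → Sem M ρ' φ × (∀ y → y ∉ zs → ρ' y ≡ ρ y)
exs-elim ρ [] φ s = ρ , s , λ _ _ → refl
exs-elim ρ (z ∷ zs) φ (v , s) with exs-elim (ρ [ z ↦ v ]) zs φ s
... | ρ' , s' , agree = ρ' , s' , λ y y∉ → trans (agree y (y∉ ∘ there)) (update-other ρ z v (y∉ ∘ here))

Sem-conjs : ∀ {M ρ} α cs → Sem M ρ (conjs α cs) ⇔ (Sem M ρ α × All (Sem M ρ) cs)
Sem-conjs α [] = (λ s → s , []) , proj₁
Sem-conjs α (c ∷ cs) =
  (λ s → let ((sα , sc) , scs) = proj₁ (Sem-conjs (α ∧ c) cs) s in sα , sc ∷ scs) ,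
  (λ { (sα , sc ∷ scs) → proj₂ (Sem-conjs (α ∧ c) cs) ((sα , sc) , scs) })

conjs-preserves : ∀ (P : Form → Set) → (∀ {φ ψ} → P φ → P ψ → P (φ ∧ ψ)) →
                  ∀ {α} cs → P α → All P cs → P (conjs α cs)
conjs-preserves P P-∧ [] pα [] = pα
conjs-preserves P P-∧ (c ∷ cs) pα (pc ∷ pcs) = conjs-preserves P P-∧ cs (P-∧ pα pc) pcs

Sem-cardEq : ∀ {M ρ x β z} → Sem M ρ (cardEq x (β , z)) ⇔ IsCard (N M) (λ i → Sem M (ρ [ x ↦ i ]) β) (ρ z)
Sem-cardEq {ρ = ρ} {z = z} =
  (λ (_ , _ , card , b≡ρz , a≡b) → subst (IsCard _ _) (trans a≡b b≡ρz) card) ,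
  (λ card → ρ z , ρ z , card , refl , refl)

⊤ᶠ : Form
⊤ᶠ = num 0ℤ ≐ num 0ℤ

⋀ : List Form → Form
⋀ = conjs ⊤ᶠ

_⇒ᶠ_ : Form → Form → Form
φ ⇒ᶠ ψ = ¬' (φ ∧ ¬' ψ)

⋀-preserves : ∀ {A : Set} (P : Form → Set) → (∀ {φ ψ} → P φ → P ψ → P (φ ∧ ψ)) → P ⊤ᶠ →
              (f : A → Form) → ∀ L → (∀ {a} → a ∈ L → P (f a)) → P (⋀ (map f L))
⋀-preserves P P-∧ P-⊤ f L P-f = conjs-preserves P P-∧ (map f L) P-⊤ (AllP.map⁺ (All.tabulate P-f))

Sem-⋀ : ∀ {A : Set} {M ρ} {P : A → Set} (f : A → Form) L → (∀ a → Sem M ρ (f a) ⇔ P a) →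
        Sem M ρ (⋀ (map f L)) ⇔ All P L
Sem-⋀ f L f⇔P =
  All.map (proj₁ (f⇔P _)) ∘ AllP.map⁻ ∘ proj₂ ∘ proj₁ (Sem-conjs ⊤ᶠ (map f L)) ,
  (λ ps → proj₂ (Sem-conjs ⊤ᶠ (map f L)) ((0ℤ , 0ℤ , refl , refl , refl) , AllP.map⁺ (All.map (proj₂ (f⇔P _)) ps)))

-- Since φ ⇒ᶠ ψ is encoded with negations, its conclusion must be decidable to be recovered.
Sem-⇒ᶠ : ∀ {M ρ φ ψ} {A B : Set} → Dec B → Sem M ρ φ ⇔ A → Sem M ρ ψ ⇔ B → Sem M ρ (φ ⇒ᶠ ψ) ⇔ (A → B)
Sem-⇒ᶠ B? (φ→A , A→φ) (ψ→B , B→ψ) =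
  (λ s a → decidable-stable B? (λ ¬b → s (A→φ a , ¬b ∘ ψ→B))) ,
  (λ h (sφ , ¬sψ) → ¬sψ (B→ψ (h (φ→A sφ))))

-- Applies to atoms between variables, numerals and N, whose values Val pins down definitionally.
atom-⇔ : ∀ {R : ℤ → ℤ → Set} {c d} → (Σ ℤ λ a → Σ ℤ λ b → (a ≡ c) × (b ≡ d) × R a b) ⇔ R c d
atom-⇔ = (λ { (_ , _ , refl , refl , r) → r }) , (λ r → _ , _ , refl , refl , r)

mutual
  NamesBelowT : ℕ → Term → Set
  NamesBelowT W (num _) = ⊤
  NamesBelowT W (par _) = ⊤
  NamesBelowT W parN = ⊤
  NamesBelowT W (var y) = y <ℕ W
  NamesBelowT W (t ⊕ u) = NamesBelowT W t × NamesBelowT W u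
  NamesBelowT W (⊖ t) = NamesBelowT W t
  NamesBelowT W (rd a t) = a <ℕ W × NamesBelowT W t
  NamesBelowT W (♯ y φ) = y <ℕ W × NamesBelow W φ

  NamesBelow : ℕ → Form → Set
  NamesBelow W (t ≺ u) = NamesBelowT W t × NamesBelowT W u
  NamesBelow W (t ≐ u) = NamesBelowT W t × NamesBelowT W u
  NamesBelow W (cng _ t u) = NamesBelowT W t × NamesBelowT W u
  NamesBelow W (φ ∧ ψ) = NamesBelow W φ × NamesBelow W ψ
  NamesBelow W (¬' φ) = NamesBelow W φ
  NamesBelow W (∃' y φ) = y <ℕ W × NamesBelow W φ

mutual
  namesBoundT : Term → ℕ
  namesBoundT (num _) = 0
  namesBoundT (par _) = 0
  namesBoundT parN = 0
  namesBoundT (var y) = suc y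
  namesBoundT (t ⊕ u) = namesBoundT t ⊔ namesBoundT u
  namesBoundT (⊖ t) = namesBoundT t
  namesBoundT (rd a t) = suc a ⊔ namesBoundT t
  namesBoundT (♯ y φ) = suc y ⊔ namesBound φ

  namesBound : Form → ℕ
  namesBound (t ≺ u) = namesBoundT t ⊔ namesBoundT u
  namesBound (t ≐ u) = namesBoundT t ⊔ namesBoundT u
  namesBound (cng _ t u) = namesBoundT t ⊔ namesBoundT u
  namesBound (φ ∧ ψ) = namesBound φ ⊔ namesBound ψ
  namesBound (¬' φ) = namesBound φ
  namesBound (∃' y φ) = suc y ⊔ namesBound φ

⊔≤⇒≤×≤ : ∀ m n {o} → m ⊔ n ≤ℕ o → m ≤ℕ o × n ≤ℕ o
⊔≤⇒≤×≤ m n m⊔n≤o = ℕP.m⊔n≤o⇒m≤o m n m⊔n≤o , ℕP.m⊔n≤o⇒n≤o m n m⊔n≤o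

mutual
  namesBelowT : ∀ t {W} → namesBoundT t ≤ℕ W → NamesBelowT W t
  namesBelowT (num _) _ = tt
  namesBelowT (par _) _ = tt
  namesBelowT parN _ = tt
  namesBelowT (var y) y<W = y<W
  namesBelowT (t ⊕ u) le = let (lt , lu) = ⊔≤⇒≤×≤ _ _ le in namesBelowT t lt , namesBelowT u lu
  namesBelowT (⊖ t) le = namesBelowT t le
  namesBelowT (rd a t) le = let (la , lt) = ⊔≤⇒≤×≤ _ _ le in la , namesBelowT t lt
  namesBelowT (♯ y φ) le = let (ly , lφ) = ⊔≤⇒≤×≤ _ _ le in ly , namesBelow φ lφ

  namesBelow : ∀ φ {W} → namesBound φ ≤ℕ W → NamesBelow W φ
  namesBelow (t ≺ u) le = let (lt , lu) = ⊔≤⇒≤×≤ _ _ le in namesBelowT t lt , namesBelowT u lu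
  namesBelow (t ≐ u) le = let (lt , lu) = ⊔≤⇒≤×≤ _ _ le in namesBelowT t lt , namesBelowT u lu
  namesBelow (cng _ t u) le = let (lt , lu) = ⊔≤⇒≤×≤ _ _ le in namesBelowT t lt , namesBelowT u lu
  namesBelow (φ ∧ ψ) le = let (lφ , lψ) = ⊔≤⇒≤×≤ _ _ le in namesBelow φ lφ , namesBelow ψ lψ
  namesBelow (¬' φ) le = namesBelow φ le
  namesBelow (∃' y φ) le = let (ly , lφ) = ⊔≤⇒≤×≤ _ _ le in ly , namesBelow φ lφ

NamesBelow-exs⁻ : ∀ {W} zs φ → NamesBelow W (exs zs φ) → All (_<ℕ W) zs × NamesBelow W φ
NamesBelow-exs⁻ [] φ nφ = [] , nφ
NamesBelow-exs⁻ (z ∷ zs) φ (z<W , nφ) = let (zs<W , nφ') = NamesBelow-exs⁻ zs φ nφ in z<W ∷ zs<W , nφ'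

NamesBelow-conjs⁻ : ∀ {W} α cs → NamesBelow W (conjs α cs) → NamesBelow W α × All (NamesBelow W) cs
NamesBelow-conjs⁻ α [] nα = nα , []
NamesBelow-conjs⁻ α (c ∷ cs) n with NamesBelow-conjs⁻ (α ∧ c) cs n
... | (nα , nc) , ncs = nα , nc ∷ ncs

AgreeBelow : ℕ → Env → Env → Set
AgreeBelow W ρ ρ' = ∀ y → y <ℕ W → ρ y ≡ ρ' y

AgreeBelow-sym : ∀ {W ρ ρ'} → AgreeBelow W ρ ρ' → AgreeBelow W ρ' ρ
AgreeBelow-sym agree y y<W = sym (agree y y<W)

AgreeBelow-update : ∀ {W ρ ρ'} x v → AgreeBelow W ρ ρ' → AgreeBelow W (ρ [ x ↦ v ]) (ρ' [ x ↦ v ])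
AgreeBelow-update x v agree y y<W with y ℕ.≟ x
... | yes _ = refl
... | no _ = agree y y<W

mutual
  Val-agree : ∀ {W ρ ρ' M v} t → NamesBelowT W t → AgreeBelow W ρ ρ' → Val M ρ t v → Val M ρ' t v
  Val-agree (num _) _ _ p = p
  Val-agree (par _) _ _ p = p
  Val-agree parN _ _ p = p
  Val-agree (var y) y<W agree p = trans p (agree y y<W)
  Val-agree (t ⊕ u) (nt , nu) agree = binary-map (Val-agree t nt agree) (Val-agree u nu agree)
  Val-agree (⊖ t) nt agree (a , p , e) = a , Val-agree t nt agree p , e
  Val-agree (rd a t) (_ , nt) agree (i , p , e) = i , Val-agree t nt agree p , e
  Val-agree (♯ y φ) (_ , nφ) agree =
    IsCard-cong (λ i _ → Sem-agree φ nφ (AgreeBelow-update y i agree))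
                (λ i _ → Sem-agree φ nφ (AgreeBelow-update y i (AgreeBelow-sym agree)))

  Sem-agree : ∀ {W ρ ρ' M} φ → NamesBelow W φ → AgreeBelow W ρ ρ' → Sem M ρ φ → Sem M ρ' φ
  Sem-agree (t ≺ u) (nt , nu) agree = binary-map (Val-agree t nt agree) (Val-agree u nu agree)
  Sem-agree (t ≐ u) (nt , nu) agree = binary-map (Val-agree t nt agree) (Val-agree u nu agree)
  Sem-agree (cng _ t u) (nt , nu) agree = binary-map (Val-agree t nt agree) (Val-agree u nu agree)
  Sem-agree (φ ∧ ψ) (nφ , nψ) agree (p , q) = Sem-agree φ nφ agree p , Sem-agree ψ nψ agree q
  Sem-agree (¬' φ) nφ agree ¬p q = ¬p (Sem-agree φ nφ (AgreeBelow-sym agree) q)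
  Sem-agree (∃' y φ) (_ , nφ) agree (v , p) = v , Sem-agree φ nφ (AgreeBelow-update y v agree) p

-- Permutation invariance of target forms

module _ {M M' : Model} (same-N : N M ≡ N M') (same-param : ∀ p → param M p ≡ param M' p) where
  Val-arith : ∀ {ρ v} t → ArithT t → Val M ρ t v → Val M' ρ t v
  Val-arith (num _) _ p = p
  Val-arith (par q) _ p = trans p (same-param q)
  Val-arith parN _ p = trans p same-N
  Val-arith (var _) _ p = p
  Val-arith (t ⊕ u) (at , au) = binary-map (Val-arith t at) (Val-arith u au)
  Val-arith (⊖ t) at (a , p , e) = a , Val-arith t at p , e

Sem-arith : ∀ {M M'} → N M ≡ N M' → (∀ p → param M p ≡ param M' p) →
            ∀ {ρ} φ → Arith φ → Sem M ρ φ → Sem M' ρ φ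
Sem-arith eN eP (t ≺ u) (at , au) = binary-map (Val-arith eN eP t at) (Val-arith eN eP u au)
Sem-arith eN eP (t ≐ u) (at , au) = binary-map (Val-arith eN eP t at) (Val-arith eN eP u au)
Sem-arith eN eP (cng _ t u) (at , au) = binary-map (Val-arith eN eP t at) (Val-arith eN eP u au)
Sem-arith eN eP (φ ∧ ψ) (aφ , aψ) (p , q) = Sem-arith eN eP φ aφ p , Sem-arith eN eP ψ aψ q
Sem-arith eN eP (¬' φ) aφ ¬p q = ¬p (Sem-arith (sym eN) (sym ∘ eP) φ aφ q)
Sem-arith eN eP (∃' y φ) aφ (v , p) = v , Sem-arith eN eP φ aφ p

record AgreeAt (x : Var) (M₁ : Model) (ρ₁ : Env) (M₂ : Model) (ρ₂ : Env) : Set where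
  field
    same-N : N M₁ ≡ N M₂
    same-param : ∀ p → param M₁ p ≡ param M₂ p
    same-env : ∀ y → y ≢ x → ρ₁ y ≡ ρ₂ y
    same-reads : ∀ a → arr M₁ a (ρ₁ x) ≡ arr M₂ a (ρ₂ x)

AgreeAt-sym : ∀ {x M₁ ρ₁ M₂ ρ₂} → AgreeAt x M₁ ρ₁ M₂ ρ₂ → AgreeAt x M₂ ρ₂ M₁ ρ₁
AgreeAt-sym s = record
  { same-N = sym same-N ; same-param = sym ∘ same-param
  ; same-env = λ y y≢x → sym (same-env y y≢x) ; same-reads = sym ∘ same-reads }
  where open AgreeAt s

AgreeAt-update : ∀ {x M₁ ρ₁ M₂ ρ₂} y v → y ≢ x → AgreeAt x M₁ ρ₁ M₂ ρ₂ →
                 AgreeAt x M₁ (ρ₁ [ y ↦ v ]) M₂ (ρ₂ [ y ↦ v ])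
AgreeAt-update {x} {M₁} {ρ₁} {M₂} {ρ₂} y v y≢x s = record
  { same-N = same-N ; same-param = same-param ; same-env = env
  ; same-reads = λ a → trans (cong (arr M₁ a) (update-other ρ₁ y v (y≢x ∘ sym)))
                         (trans (same-reads a) (cong (arr M₂ a) (sym (update-other ρ₂ y v (y≢x ∘ sym))))) }
  where
  open AgreeAt s
  env : ∀ z → z ≢ x → (ρ₁ [ y ↦ v ]) z ≡ (ρ₂ [ y ↦ v ]) z
  env z z≢x with z ℕ.≟ y
  ... | yes _ = refl
  ... | no _ = same-env z z≢x

readsAt-var : ∀ {x a t} → ReadsAtT x (rd a t) → t ≡ var x
readsAt-var {t = var y} refl = refl
readsAt-var {t = num _} ()
readsAt-var {t = par _} ()
readsAt-var {t = parN} ()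
readsAt-var {t = _ ⊕ _} ()
readsAt-var {t = ⊖ _} ()
readsAt-var {t = rd _ _} ()
readsAt-var {t = ♯ _ _} ()

mutual
  Val-readsAt : ∀ {x M₁ ρ₁ M₂ ρ₂ v} t → ReadsAtT x t → AgreeAt x M₁ ρ₁ M₂ ρ₂ →
                Val M₁ ρ₁ t v → Val M₂ ρ₂ t v
  Val-readsAt (num _) _ s p = p
  Val-readsAt (par q) _ s p = trans p (AgreeAt.same-param s q)
  Val-readsAt parN _ s p = trans p (AgreeAt.same-N s)
  Val-readsAt (var y) y≢x s p = trans p (AgreeAt.same-env s y y≢x)
  Val-readsAt (t ⊕ u) (rt , ru) s = binary-map (Val-readsAt t rt s) (Val-readsAt u ru s)
  Val-readsAt (⊖ t) rt s (a , p , e) = a , Val-readsAt t rt s p , e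
  Val-readsAt {M₁ = M₁} {ρ₂ = ρ₂} (rd a t) rt s (_ , p , e) with readsAt-var {t = t} rt
  ... | refl = ρ₂ _ , refl , trans e (trans (cong (arr M₁ a) p) (AgreeAt.same-reads s a))

  Sem-readsAt : ∀ {x M₁ ρ₁ M₂ ρ₂} φ → ReadsAt x φ → AgreeAt x M₁ ρ₁ M₂ ρ₂ →
                Sem M₁ ρ₁ φ → Sem M₂ ρ₂ φ
  Sem-readsAt (t ≺ u) (rt , ru) s = binary-map (Val-readsAt t rt s) (Val-readsAt u ru s)
  Sem-readsAt (t ≐ u) (rt , ru) s = binary-map (Val-readsAt t rt s) (Val-readsAt u ru s)
  Sem-readsAt (cng _ t u) (rt , ru) s = binary-map (Val-readsAt t rt s) (Val-readsAt u ru s)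
  Sem-readsAt (φ ∧ ψ) (rφ , rψ) s (p , q) = Sem-readsAt φ rφ s p , Sem-readsAt ψ rψ s q
  Sem-readsAt (¬' φ) rφ s ¬p q = ¬p (Sem-readsAt φ rφ (AgreeAt-sym s) q)
  Sem-readsAt (∃' y φ) (y≢x , rφ) s (v , p) = v , Sem-readsAt φ rφ (AgreeAt-update y v y≢x s) p

SameTruth : Model → Model → Form → Set
SameTruth M M' φ = ∀ ρ → Sem M ρ φ ⇔ Sem M' ρ φ

SameTruth-∧ : ∀ {M M' φ ψ} → SameTruth M M' φ → SameTruth M M' ψ → SameTruth M M' (φ ∧ ψ)
SameTruth-∧ sφ sψ ρ = sφ ρ ×-⇔ sψ ρ

SameTruth-exs : ∀ {M M' φ} zs → SameTruth M M' φ → SameTruth M M' (exs zs φ)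
SameTruth-exs [] s = s
SameTruth-exs (z ∷ zs) s ρ = Σ-⇔ λ {v} → SameTruth-exs zs s (ρ [ z ↦ v ])

module _ (M : Model) (π : Perm (N M)) where
  open Perm π

  private
    M' : Model
    M' = permute M π

  SameTruth-arith : ∀ α → Arith α → SameTruth M M' α
  SameTruth-arith α aα ρ = Sem-arith refl (λ _ → refl) α aα , Sem-arith refl (λ _ → refl) α aα

  AgreeAt-permute : ∀ x ρ i → InRange (N M) i → AgreeAt x M (ρ [ x ↦ f i ]) M' (ρ [ x ↦ i ])
  AgreeAt-permute x ρ i r = record
    { same-N = refl ; same-param = λ _ → refl
    ; same-env = λ y y≢x → trans (update-other ρ x (f i) y≢x) (sym (update-other ρ x i y≢x))
    ; same-reads = λ a → trans (cong (arr M a) (update-same ρ x (f i)))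
        (sym (trans (cong (arr M' a) (update-same ρ x i)) (permArr-inRange (N M) π (arr M) a i r))) }

  AgreeAt-unpermute : ∀ x ρ i → InRange (N M) i → AgreeAt x M (ρ [ x ↦ i ]) M' (ρ [ x ↦ g i ])
  AgreeAt-unpermute x ρ i r =
    subst (λ j → AgreeAt x M (ρ [ x ↦ j ]) M' (ρ [ x ↦ g i ])) (f∘g i r) (AgreeAt-permute x ρ (g i) (g-in i r))

  SameTruth-cardEq : ∀ x β z → ReadsAt x β → SameTruth M M' (cardEq x (β , z))
  SameTruth-cardEq x β z rβ ρ =
    binary-map (IsCard-cong (λ i r → Sem-readsAt β rβ (AgreeAt-permute x ρ i r))
                            (λ i r → Sem-readsAt β rβ (AgreeAt-sym (AgreeAt-permute x ρ i r)))
                ∘ IsCard-perm π) (λ p → p) ,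
    binary-map (IsCard-cong (λ i r → Sem-readsAt β rβ (AgreeAt-sym (AgreeAt-unpermute x ρ i r)))
                            (λ i r → Sem-readsAt β rβ (AgreeAt-unpermute x ρ i r))
                ∘ IsCard-perm (Perm-inverse π)) (λ p → p)

  SameTruth-flatBody : ∀ x α cs → Arith α → All (ReadsAt x ∘ proj₁) cs → SameTruth M M' (conjs α (map (cardEq x) cs))
  SameTruth-flatBody x α cs aα rcs =
    conjs-preserves (SameTruth M M') SameTruth-∧ (map (cardEq x) cs) (SameTruth-arith α aα)
      (AllP.map⁺ (All.map (λ {(β , z)} → SameTruth-cardEq x β z) rcs))

TargetForm⇒PermInvariant : ∀ ψ → TargetForm ψ → PermInvariant ψ
TargetForm⇒PermInvariant ψ (x , α , cs , refl , _ , _ , aα , _ , rcs) M π =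
  SameTruth-exs (map proj₂ cs) (SameTruth-flatBody M π x α cs aα rcs)

-- Elimination of reads

-- shadow a r is the variable standing for the read a(r) of an index r < W.
module Shadows (W : ℕ) .{{_ : ℕ.NonZero W}} where
  shadow : ArrayId → Var → Var
  shadow a r = r +ℕ suc a *ℕ W

  W≤shadow : ∀ a r → W ≤ℕ shadow a r
  W≤shadow a r = ℕP.≤-trans (ℕP.m≤m+n W (a *ℕ W)) (ℕP.m≤n+m (suc a *ℕ W) r)

  shadow≢ : ∀ {y} a r → y <ℕ W → shadow a r ≢ y
  shadow≢ a r y<W refl = ℕP.<⇒≱ y<W (W≤shadow a r)

  shadow%W : ∀ a r → r <ℕ W → shadow a r % W ≡ r
  shadow%W a r r<W = trans ([m+kn]%n≡m%n r (suc a) W) (m<n⇒m%n≡m r<W)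

  shadow/W : ∀ a r → r <ℕ W → shadow a r / W ≡ suc a
  shadow/W a r r<W = trans (+-distrib-/ r (suc a *ℕ W) remainders<W)
                           (cong₂ _+ℕ_ (m<n⇒m/n≡0 r<W) (m*n/n≡m (suc a) W))
    where
    remainders<W : r % W +ℕ (suc a *ℕ W) % W <ℕ W
    remainders<W = subst (_<ℕ W) (sym (trans (cong₂ _+ℕ_ (m<n⇒m%n≡m r<W) (m*n%n≡0 (suc a) W)) (ℕP.+-identityʳ r))) r<W

  shadow-injective : ∀ {a r a' r'} → r <ℕ W → r' <ℕ W → shadow a r ≡ shadow a' r' → a ≡ a' × r ≡ r'
  shadow-injective {a} {r} {a'} {r'} r<W r'<W e =
    ℕP.suc-injective (trans (sym (shadow/W a r r<W)) (trans (cong (_/ W) e) (shadow/W a' r' r'<W))) ,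
    trans (sym (shadow%W a r r<W)) (trans (cong (_% W) e) (shadow%W a' r' r'<W))

basic-read : ∀ {B a t} → BasicT B (rd a t) → ∃ λ y → t ≡ var y × y ∉ B
basic-read {t = var y} y∉B = y , refl , y∉B
basic-read {t = num _} ()
basic-read {t = par _} ()
basic-read {t = parN} ()
basic-read {t = _ ⊕ _} ()
basic-read {t = ⊖ _} ()
basic-read {t = rd _ _} ()
basic-read {t = ♯ _ _} ()

module ReadElimination (W : ℕ) .{{_ : ℕ.NonZero W}} (x : Var) where
  open Shadows W public

  elimRead : ArrayId → Var → Term
  elimRead a r with r ℕ.≟ x
  ... | yes _ = rd a (var r)
  ... | no _ = var (shadow a r)

  mutual
    elimT : Term → Term
    elimT (num n) = num n
    elimT (par p) = par p
    elimT parN = parN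
    elimT (var y) = var y
    elimT (t ⊕ u) = elimT t ⊕ elimT u
    elimT (⊖ t) = ⊖ elimT t
    elimT (rd a (var r)) = elimRead a r
    elimT (rd a t) = rd a (elimT t)
    elimT (♯ y φ) = ♯ y (elim φ)

    elim : Form → Form
    elim (t ≺ u) = elimT t ≺ elimT u
    elim (t ≐ u) = elimT t ≐ elimT u
    elim (cng n t u) = cng n (elimT t) (elimT u)
    elim (φ ∧ ψ) = elim φ ∧ elim ψ
    elim (¬' φ) = ¬' (elim φ)
    elim (∃' y φ) = ∃' y (elim φ)

  -- B lists the variables bound at the current position; basic formulas never read at them.
  ShadowsMatch : Model → List Var → Env → Set
  ShadowsMatch M B ρ = ∀ a r → a <ℕ W → r <ℕ W → r ≢ x → r ∉ B → ρ (shadow a r) ≡ arr M a (ρ r)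

  ShadowsMatch-bind : ∀ {M B ρ} y v → y <ℕ W → ShadowsMatch M B ρ → ShadowsMatch M (y ∷ B) (ρ [ y ↦ v ])
  ShadowsMatch-bind {M} {B} {ρ} y v y<W match a r a<W r<W r≢x r∉yB =
    trans (update-other ρ y v (shadow≢ a r y<W))
      (trans (match a r a<W r<W r≢x (r∉yB ∘ there)) (cong (arr M a) (sym (update-other ρ y v (r∉yB ∘ here)))))

  ShadowsMatch-index : ∀ {M B ρ} v → x <ℕ W → ShadowsMatch M B ρ → ShadowsMatch M B (ρ [ x ↦ v ])
  ShadowsMatch-index {M} {B} {ρ} v x<W match a r a<W r<W r≢x r∉B =
    trans (update-other ρ x v (shadow≢ a r x<W))
      (trans (match a r a<W r<W r≢x r∉B) (cong (arr M a) (sym (update-other ρ x v r≢x))))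

  mutual
    Val-elim : ∀ {M B ρ v} t → NamesBelowT W t → BasicT B t → ShadowsMatch M B ρ →
               Val M ρ t v ⇔ Val M ρ (elimT t) v
    Val-elim (num _) _ _ _ = ⇔-refl
    Val-elim (par _) _ _ _ = ⇔-refl
    Val-elim parN _ _ _ = ⇔-refl
    Val-elim (var _) _ _ _ = ⇔-refl
    Val-elim (t ⊕ u) (nt , nu) (bt , bu) match = binary-⇔ (Val-elim t nt bt match) (Val-elim u nu bu match)
    Val-elim (⊖ t) nt bt match = Σ-⇔ (Val-elim t nt bt match ×-⇔ ⇔-refl)
    Val-elim (rd a t) (a<W , nt) bt match with basic-read {t = t} bt
    ... | r , refl , r∉B with r ℕ.≟ x
    ...   | yes _ = ⇔-refl
    ...   | no r≢x = (λ { (_ , refl , refl) → sym (match a r a<W nt r≢x r∉B) }) ,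
                     (λ p → _ , refl , trans p (match a r a<W nt r≢x r∉B))

    Sem-elim : ∀ {M B ρ} φ → NamesBelow W φ → BasicF B φ → ShadowsMatch M B ρ → Sem M ρ φ ⇔ Sem M ρ (elim φ)
    Sem-elim (t ≺ u) (nt , nu) (bt , bu) match = binary-⇔ (Val-elim t nt bt match) (Val-elim u nu bu match)
    Sem-elim (t ≐ u) (nt , nu) (bt , bu) match = binary-⇔ (Val-elim t nt bt match) (Val-elim u nu bu match)
    Sem-elim (cng _ t u) (nt , nu) (bt , bu) match = binary-⇔ (Val-elim t nt bt match) (Val-elim u nu bu match)
    Sem-elim (φ ∧ ψ) (nφ , nψ) (bφ , bψ) match = Sem-elim φ nφ bφ match ×-⇔ Sem-elim ψ nψ bψ match
    Sem-elim (¬' φ) nφ bφ match = ¬-⇔ (Sem-elim φ nφ bφ match)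
    Sem-elim {M} (∃' y φ) (y<W , nφ) bφ match = Σ-⇔ λ {v} → Sem-elim φ nφ bφ (ShadowsMatch-bind {M} y v y<W match)

  module _ (x<W : x <ℕ W) where
    mutual
      ArithT-elim : ∀ {B} t → BasicT B t → NotOccT x t → ArithT (elimT t)
      ArithT-elim (num _) _ _ = tt
      ArithT-elim (par _) _ _ = tt
      ArithT-elim parN _ _ = tt
      ArithT-elim (var _) _ _ = tt
      ArithT-elim (t ⊕ u) (bt , bu) (ot , ou) = ArithT-elim t bt ot , ArithT-elim u bu ou
      ArithT-elim (⊖ t) bt ot = ArithT-elim t bt ot
      ArithT-elim (rd a t) bt ot with basic-read {t = t} bt
      ... | r , refl , _ with r ℕ.≟ x
      ...   | yes r≡x = ⊥-elim (ot r≡x)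
      ...   | no _ = tt

      Arith-elim : ∀ {B} φ → BasicF B φ → NotOcc x φ → Arith (elim φ)
      Arith-elim (t ≺ u) (bt , bu) (ot , ou) = ArithT-elim t bt ot , ArithT-elim u bu ou
      Arith-elim (t ≐ u) (bt , bu) (ot , ou) = ArithT-elim t bt ot , ArithT-elim u bu ou
      Arith-elim (cng _ t u) (bt , bu) (ot , ou) = ArithT-elim t bt ot , ArithT-elim u bu ou
      Arith-elim (φ ∧ ψ) (bφ , bψ) (oφ , oψ) = Arith-elim φ bφ oφ , Arith-elim ψ bψ oψ
      Arith-elim (¬' φ) bφ oφ = Arith-elim φ bφ oφ
      Arith-elim (∃' y φ) bφ (_ , oφ) = Arith-elim φ bφ oφ

    mutual
      NotOccT-elim : ∀ {B} t → BasicT B t → NotOccT x t → NotOccT x (elimT t)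
      NotOccT-elim (num _) _ _ = tt
      NotOccT-elim (par _) _ _ = tt
      NotOccT-elim parN _ _ = tt
      NotOccT-elim (var _) _ ot = ot
      NotOccT-elim (t ⊕ u) (bt , bu) (ot , ou) = NotOccT-elim t bt ot , NotOccT-elim u bu ou
      NotOccT-elim (⊖ t) bt ot = NotOccT-elim t bt ot
      NotOccT-elim (rd a t) bt ot with basic-read {t = t} bt
      ... | r , refl , _ with r ℕ.≟ x
      ...   | yes r≡x = ⊥-elim (ot r≡x)
      ...   | no _ = shadow≢ a r x<W

      NotOcc-elim : ∀ {B} φ → BasicF B φ → NotOcc x φ → NotOcc x (elim φ)
      NotOcc-elim (t ≺ u) (bt , bu) (ot , ou) = NotOccT-elim t bt ot , NotOccT-elim u bu ou
      NotOcc-elim (t ≐ u) (bt , bu) (ot , ou) = NotOccT-elim t bt ot , NotOccT-elim u bu ou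
      NotOcc-elim (cng _ t u) (bt , bu) (ot , ou) = NotOccT-elim t bt ot , NotOccT-elim u bu ou
      NotOcc-elim (φ ∧ ψ) (bφ , bψ) (oφ , oψ) = NotOcc-elim φ bφ oφ , NotOcc-elim ψ bψ oψ
      NotOcc-elim (¬' φ) bφ oφ = NotOcc-elim φ bφ oφ
      NotOcc-elim (∃' y φ) bφ (y≢x , oφ) = y≢x , NotOcc-elim φ bφ oφ

    mutual
      ReadsAtT-elim : ∀ {B} t → BasicT B t → OnlyInReadsT x t → ReadsAtT x (elimT t)
      ReadsAtT-elim (num _) _ _ = tt
      ReadsAtT-elim (par _) _ _ = tt
      ReadsAtT-elim parN _ _ = tt
      ReadsAtT-elim (var _) _ ot = ot
      ReadsAtT-elim (t ⊕ u) (bt , bu) (ot , ou) = ReadsAtT-elim t bt ot , ReadsAtT-elim u bu ou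
      ReadsAtT-elim (⊖ t) bt ot = ReadsAtT-elim t bt ot
      ReadsAtT-elim (rd a t) bt _ with basic-read {t = t} bt
      ... | r , refl , _ with r ℕ.≟ x
      ...   | yes r≡x = r≡x
      ...   | no _ = shadow≢ a r x<W

      ReadsAt-elim : ∀ {B} φ → BasicF B φ → OnlyInReads x φ → ReadsAt x (elim φ)
      ReadsAt-elim (t ≺ u) (bt , bu) (ot , ou) = ReadsAtT-elim t bt ot , ReadsAtT-elim u bu ou
      ReadsAt-elim (t ≐ u) (bt , bu) (ot , ou) = ReadsAtT-elim t bt ot , ReadsAtT-elim u bu ou
      ReadsAt-elim (cng _ t u) (bt , bu) (ot , ou) = ReadsAtT-elim t bt ot , ReadsAtT-elim u bu ou
      ReadsAt-elim (φ ∧ ψ) (bφ , bψ) (oφ , oψ) = ReadsAt-elim φ bφ oφ , ReadsAt-elim ψ bψ oψ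
      ReadsAt-elim (¬' φ) bφ oφ = ReadsAt-elim φ bφ oφ
      ReadsAt-elim (∃' y φ) bφ (y≢x , oφ) = y≢x , ReadsAt-elim φ bφ oφ

module Constraints (W : ℕ) .{{_ : ℕ.NonZero W}} (x : Var) where
  open Shadows W

  indices : List Var
  indices = filter (λ r → ¬? (r ℕ.≟ x)) (downFrom W)

  ∈-indices⁺ : ∀ {r} → r <ℕ W → r ≢ x → r ∈ indices
  ∈-indices⁺ r<W r≢x = ∈-filter⁺ (λ r → ¬? (r ℕ.≟ x)) (∈-downFrom⁺ r<W) r≢x

  ∈-indices⁻ : ∀ {r} → r ∈ indices → r <ℕ W × r ≢ x
  ∈-indices⁻ r∈ with ∈-filter⁻ (λ r → ¬? (r ℕ.≟ x)) {xs = downFrom W} r∈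
  ... | r∈' , r≢x = ∈-downFrom⁻ r∈' , r≢x

  indices-unique : Unique indices
  indices-unique = UniqueP.filter⁺ (λ r → ¬? (r ℕ.≟ x)) (UniqueP.downFrom⁺ W)

  arrays : List ArrayId
  arrays = downFrom W

  -- Array-ids are below W, so the counters never clash with shadows.
  countVar : Var → Var
  countVar = shadow W

  readsᶠ : Var → Form
  readsᶠ r = ⋀ (map (λ a → rd a (var x) ≐ var (shadow a r)) arrays)

  shadowsEqᶠ : Var → Var → Form
  shadowsEqᶠ r r' = ⋀ (map (λ a → var (shadow a r) ≐ var (shadow a r')) arrays)

  shadowsZeroᶠ : Var → Form
  shadowsZeroᶠ r = ⋀ (map (λ a → var (shadow a r) ≐ num 0ℤ) arrays)

  inRangeᶠ : Var → Form
  inRangeᶠ r = ¬' (var r ≺ num 0ℤ) ∧ (var r ≺ parN)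

  distinctᶠ : List Var → Form
  distinctᶠ [] = ⊤ᶠ
  distinctᶠ (r ∷ t) = ⋀ (map (λ r' → ¬' (var r ≐ var r')) t) ∧ distinctᶠ t

  hallPremiseᶠ : Var → List Var → Form
  hallPremiseᶠ h t = inRangeᶠ h ∧ (⋀ (map inRangeᶠ t) ∧ (distinctᶠ (h ∷ t) ∧ ⋀ (map (λ r → shadowsEqᶠ r h) t)))

  hallᶠ : Var → List Var → Form
  hallᶠ h t = hallPremiseᶠ h t ⇒ᶠ (num (+ length t) ≺ var (countVar h))

  zeroOutsideᶠ : Var → Form
  zeroOutsideᶠ r = ¬' (inRangeᶠ r) ⇒ᶠ shadowsZeroᶠ r

  functionalᶠ : Var → Var → Form
  functionalᶠ r r' = (var r ≐ var r') ⇒ᶠ shadowsEqᶠ r r'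

  allFunctionalᶠ : Var → Form
  allFunctionalᶠ r = ⋀ (map (functionalᶠ r) indices)

  allHallᶠ : Var → Form
  allHallᶠ h = ⋀ (map (hallᶠ h) (subsequences indices))

  consistencyᶠ : Form
  consistencyᶠ = ⋀ (map zeroOutsideᶠ indices) ∧ (⋀ (map allFunctionalᶠ indices) ∧ ⋀ (map allHallᶠ indices))

  dec-arrays : ∀ {P : ArrayId → Set} → (∀ a → Dec (P a)) → Dec (∀ a → a <ℕ W → P a)
  dec-arrays P? = map′ All-downFrom⁻ (All-downFrom⁺ W) (All.all? P? arrays)

  module _ {M : Model} {ρ : Env} where
    ShadowsEq : Var → Var → Set
    ShadowsEq r r' = ∀ a → a <ℕ W → ρ (shadow a r) ≡ ρ (shadow a r')

    ShadowsZero : Var → Set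
    ShadowsZero r = ∀ a → a <ℕ W → ρ (shadow a r) ≡ 0ℤ

    HallPremise : Var → List Var → Set
    HallPremise h t = InRange (N M) (ρ h) × All (λ r → InRange (N M) (ρ r)) t
                      × Unique (map ρ (h ∷ t)) × All (λ r → ShadowsEq r h) t

    record Consistent : Set where
      field
        outside-zero : All (λ r → ¬ InRange (N M) (ρ r) → ShadowsZero r) indices
        functional : All (λ r → All (λ r' → ρ r ≡ ρ r' → ShadowsEq r r') indices) indices
        hall : All (λ h → All (λ t → HallPremise h t → + length t < ρ (countVar h)) (subsequences indices)) indices

    Sem-⋀-arrays : ∀ {P : ArrayId → Set} (f : ArrayId → Form) → (∀ a → Sem M ρ (f a) ⇔ P a) →
                   Sem M ρ (⋀ (map f arrays)) ⇔ (∀ a → a <ℕ W → P a)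
    Sem-⋀-arrays f f⇔P = ⇔-trans (Sem-⋀ f arrays f⇔P) (All-downFrom⁻ , All-downFrom⁺ W)

    Sem-shadowsEqᶠ : ∀ r r' → Sem M ρ (shadowsEqᶠ r r') ⇔ ShadowsEq r r'
    Sem-shadowsEqᶠ r r' = Sem-⋀-arrays (λ a → var (shadow a r) ≐ var (shadow a r')) (λ _ → atom-⇔)

    Sem-inRangeᶠ : ∀ r → Sem M ρ (inRangeᶠ r) ⇔ InRange (N M) (ρ r)
    Sem-inRangeᶠ r = (λ (¬r<0 , r<N) → ℤP.≮⇒≥ (¬r<0 ∘ proj₂ atom-⇔) , proj₁ atom-⇔ r<N) ,
                     (λ (0≤r , r<N) → ℤP.≤⇒≯ 0≤r ∘ proj₁ atom-⇔ , proj₂ atom-⇔ r<N)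

    Sem-distinctᶠ : ∀ L → Sem M ρ (distinctᶠ L) ⇔ Unique (map ρ L)
    Sem-distinctᶠ [] = (λ _ → []) , (λ _ → 0ℤ , 0ℤ , refl , refl , refl)
    Sem-distinctᶠ (r ∷ t) =
      (λ (s , st) → AllP.map⁺ (proj₁ head-distinct s) ∷ proj₁ (Sem-distinctᶠ t) st) ,
      (λ { (r∉ ∷ u) → proj₂ head-distinct (AllP.map⁻ r∉) , proj₂ (Sem-distinctᶠ t) u })
      where
      head-distinct = Sem-⋀ (λ r' → ¬' (var r ≐ var r')) t (λ r' → ¬-⇔ atom-⇔)

    Sem-hallᶠ : ∀ h t → Sem M ρ (hallᶠ h t) ⇔ (HallPremise h t → + length t < ρ (countVar h))
    Sem-hallᶠ h t =
      Sem-⇒ᶠ {M} {ρ} {hallPremiseᶠ h t} {num (+ length t) ≺ var (countVar h)} (+ length t ℤ.<? ρ (countVar h))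
      (Sem-inRangeᶠ h ×-⇔ (Sem-⋀ {M = M} {ρ} inRangeᶠ t Sem-inRangeᶠ ×-⇔
        (Sem-distinctᶠ (h ∷ t) ×-⇔ Sem-⋀ (λ r → shadowsEqᶠ r h) t (λ r → Sem-shadowsEqᶠ r h))))
      atom-⇔

    Sem-consistencyᶠ : Sem M ρ consistencyᶠ ⇔ Consistent
    Sem-consistencyᶠ =
      (λ s → let (z , f , h) = proj₁ parts s in record { outside-zero = z ; functional = f ; hall = h }) ,
      (λ c → proj₂ parts (Consistent.outside-zero c , Consistent.functional c , Consistent.hall c))
      where
      zero-part = Sem-⋀ zeroOutsideᶠ indices λ r →
        Sem-⇒ᶠ {M} {ρ} {¬' (inRangeᶠ r)} {shadowsZeroᶠ r} (dec-arrays (λ a → ρ (shadow a r) ℤP.≟ 0ℤ))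
          (¬-⇔ (Sem-inRangeᶠ r)) (Sem-⋀-arrays (λ a → var (shadow a r) ≐ num 0ℤ) (λ _ → atom-⇔))
      functional-part = Sem-⋀ allFunctionalᶠ indices λ r → Sem-⋀ (functionalᶠ r) indices λ r' →
        Sem-⇒ᶠ {M} {ρ} {var r ≐ var r'} {shadowsEqᶠ r r'} (dec-arrays (λ a → ρ (shadow a r) ℤP.≟ ρ (shadow a r')))
          atom-⇔ (Sem-shadowsEqᶠ r r')
      hall-part = Sem-⋀ allHallᶠ indices λ h → Sem-⋀ (hallᶠ h) (subsequences indices) (Sem-hallᶠ h)
      parts = zero-part ×-⇔ (functional-part ×-⇔ hall-part)

  module _ (x<W : x <ℕ W) where
    record Pure (φ : Form) : Set where
      constructor pure
      field
        arith : Arith φ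
        not-occ : NotOcc x φ

    Pure-∧ : ∀ {φ ψ} → Pure φ → Pure ψ → Pure (φ ∧ ψ)
    Pure-∧ (pure aφ oφ) (pure aψ oψ) = pure (aφ , aψ) (oφ , oψ)

    Pure-¬ : ∀ {φ} → Pure φ → Pure (¬' φ)
    Pure-¬ (pure aφ oφ) = pure aφ oφ

    Pure-⇒ : ∀ {φ ψ} → Pure φ → Pure ψ → Pure (φ ⇒ᶠ ψ)
    Pure-⇒ pφ pψ = Pure-¬ (Pure-∧ pφ (Pure-¬ pψ))

    Pure-⋀ : ∀ {A : Set} (f : A → Form) L → (∀ {a} → a ∈ L → Pure (f a)) → Pure (⋀ (map f L))
    Pure-⋀ = ⋀-preserves Pure Pure-∧ (pure (tt , tt) (tt , tt))

    Pure-vars : ∀ {r r'} → r ≢ x → r' ≢ x → Pure (var r ≐ var r')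
    Pure-vars r≢x r'≢x = pure (tt , tt) (r≢x , r'≢x)

    Pure-shadowsEqᶠ : ∀ r r' → Pure (shadowsEqᶠ r r')
    Pure-shadowsEqᶠ r r' = Pure-⋀ (λ a → var (shadow a r) ≐ var (shadow a r')) arrays
      (λ {a} _ → Pure-vars (shadow≢ a r x<W) (shadow≢ a r' x<W))

    Pure-inRangeᶠ : ∀ {r} → r ≢ x → Pure (inRangeᶠ r)
    Pure-inRangeᶠ r≢x = pure ((tt , tt) , (tt , tt)) ((r≢x , tt) , (r≢x , tt))

    Pure-distinctᶠ : ∀ t → All (_≢ x) t → Pure (distinctᶠ t)
    Pure-distinctᶠ [] _ = pure (tt , tt) (tt , tt)
    Pure-distinctᶠ (r ∷ t) (r≢x ∷ t≢x) =
      Pure-∧ (Pure-⋀ (λ r' → ¬' (var r ≐ var r')) t (Pure-¬ ∘ Pure-vars r≢x ∘ All.lookup t≢x))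
             (Pure-distinctᶠ t t≢x)

    Pure-hallᶠ : ∀ {h} t → h ≢ x → All (_≢ x) t → Pure (hallᶠ h t)
    Pure-hallᶠ {h} t h≢x t≢x =
      Pure-⇒ (Pure-∧ (Pure-inRangeᶠ h≢x) (Pure-∧ (Pure-⋀ inRangeᶠ t (Pure-inRangeᶠ ∘ All.lookup t≢x))
               (Pure-∧ (Pure-distinctᶠ (h ∷ t) (h≢x ∷ t≢x))
                       (Pure-⋀ (λ r → shadowsEqᶠ r h) t (λ {r} _ → Pure-shadowsEqᶠ r h)))))
             (pure (tt , tt) (tt , shadow≢ W h x<W))

    Pure-consistencyᶠ : Pure consistencyᶠ
    Pure-consistencyᶠ =
      Pure-∧ (Pure-⋀ zeroOutsideᶠ indices λ {r} r∈ →
               Pure-⇒ (Pure-¬ (Pure-inRangeᶠ (index≢x r∈)))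
                      (Pure-⋀ (λ a → var (shadow a r) ≐ num 0ℤ) arrays (λ {a} _ → pure (tt , tt) (shadow≢ a r x<W , tt))))
      (Pure-∧ (Pure-⋀ allFunctionalᶠ indices λ {r} r∈ → Pure-⋀ (functionalᶠ r) indices λ {r'} r'∈ →
                 Pure-⇒ (Pure-vars (index≢x r∈) (index≢x r'∈)) (Pure-shadowsEqᶠ r r'))
              (Pure-⋀ allHallᶠ indices λ {h} h∈ → Pure-⋀ (hallᶠ h) (subsequences indices) λ {t} t∈ →
                 Pure-hallᶠ t (index≢x h∈)
                   (AllP.anti-mono (⊑-lookup (∈-subsequences⁻ indices t∈)) (All.tabulate index≢x))))
      where
      index≢x : ∀ {r} → r ∈ indices → r ≢ x
      index≢x = proj₂ ∘ ∈-indices⁻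

    ReadsAt-readsᶠ : ∀ r → ReadsAt x (readsᶠ r)
    ReadsAt-readsᶠ r = ⋀-preserves (ReadsAt x) _,_ (tt , tt) (λ a → rd a (var x) ≐ var (shadow a r)) arrays
                         (λ {a} _ → refl , shadow≢ a r x<W)

    Sem-readsᶠ : ∀ {M ρ i} r → Sem M (ρ [ x ↦ i ]) (readsᶠ r) ⇔ (∀ a → a <ℕ W → arr M a i ≡ ρ (shadow a r))
    Sem-readsᶠ {M} {ρ} {i} r = Sem-⋀-arrays (λ a → rd a (var x) ≐ var (shadow a r)) λ a →
      (λ { (_ , _ , (_ , refl , refl) , refl , e) →
             trans (cong (arr M a) (sym (update-same ρ x i))) (trans e (update-other ρ x i (shadow≢ a r x<W))) }) ,
      (λ e → _ , _ , (_ , refl , refl) , refl ,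
             trans (cong (arr M a) (update-same ρ x i)) (trans e (sym (update-other ρ x i (shadow≢ a r x<W)))))

-- The reduction

module Reduction (x : Var) (α : Form) (cs : List (Form × Var))
  (zs-unique : Unique (map proj₂ cs)) (x∉zs : x ∉ map proj₂ cs) (bα : Basic α) (oα : NotOcc x α)
  (bcs : All (λ c → Basic (proj₁ c) × OnlyInReads x (proj₁ c)) cs) where

  φ : Form
  φ = flatForm x α cs

  -- All names of φ are below W, so the shadow and counter variables (≥ W) are fresh.
  W : ℕ
  W = suc (x ⊔ namesBound φ)

  x<W : x <ℕ W
  x<W = s≤s (ℕP.m≤m⊔n x (namesBound φ))

  open ReadElimination W x
  open Constraints W x

  zs : List Var
  zs = map proj₂ cs

  body : Form
  body = conjs α (map (cardEq x) cs)

  nbody : NamesBelow W body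
  nbody = proj₂ (NamesBelow-exs⁻ zs body (namesBelow φ (ℕP.m≤n⇒m≤1+n (ℕP.m≤n⊔m x (namesBound φ)))))

  nα : NamesBelow W α
  nα = proj₁ (NamesBelow-conjs⁻ α (map (cardEq x) cs) nbody)

  ncs : All (NamesBelow W ∘ cardEq x) cs
  ncs = AllP.map⁻ (proj₂ (NamesBelow-conjs⁻ α (map (cardEq x) cs) nbody))

  elimCard : Form × Var → Form × Var
  elimCard c = elim (proj₁ c) , proj₂ c

  countCard : Var → Form × Var
  countCard r = readsᶠ r , countVar r

  α' : Form
  α' = elim α ∧ consistencyᶠ

  cs' : List (Form × Var)
  cs' = map elimCard cs ++ map countCard indices

  ψ : Form
  ψ = flatForm x α' cs'

  χ : Form
  χ = conjs α' (map (cardEq x) cs')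

  Zs : List Var
  Zs = map proj₂ cs'

  Zs≡ : Zs ≡ zs ++ map countVar indices
  Zs≡ = trans (map-++ proj₂ (map elimCard cs) (map countCard indices))
              (cong₂ _++_ (sym (map-∘ cs)) (sym (map-∘ indices)))

  zs<W : All (_<ℕ W) zs
  zs<W = AllP.map⁺ (All.map (λ {c} → proj₂) ncs)

  countVar-injective : ∀ {r r'} → countVar r ≡ countVar r' → r ≡ r'
  countVar-injective {r} {r'} = ℕP.+-cancelʳ-≡ (suc W *ℕ W) r r'

  <W⇒∉countVars : ∀ {y} → y <ℕ W → y ∉ map countVar indices
  <W⇒∉countVars y<W y∈ with ∈-map⁻ countVar y∈
  ... | r , _ , refl = shadow≢ W r y<W refl

  ∈-Zs⁻ : ∀ {y} → y ∈ Zs → y ∈ zs ⊎ y ∈ map countVar indices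
  ∈-Zs⁻ {y} y∈ = ∈-++⁻ zs (subst (y ∈_) Zs≡ y∈)

  ∈-Zs-countVar : ∀ {r} → r ∈ indices → countVar r ∈ Zs
  ∈-Zs-countVar {r} r∈ = subst (countVar r ∈_) (sym Zs≡) (∈-++⁺ʳ zs (∈-map⁺ countVar r∈))

  ∈-zs⇒∈-Zs : ∀ {y} → y ∈ zs → y ∈ Zs
  ∈-zs⇒∈-Zs {y} y∈ = subst (y ∈_) (sym Zs≡) (∈-++⁺ˡ y∈)

  ∉-Zs-low : ∀ {y} → y <ℕ W → y ∉ zs → y ∉ Zs
  ∉-Zs-low y<W y∉ y∈ with ∈-Zs⁻ y∈
  ... | inj₁ y∈zs = y∉ y∈zs
  ... | inj₂ y∈cv = <W⇒∉countVars y<W y∈cv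

  ∉-Zs-shadow : ∀ {a r} → a <ℕ W → r <ℕ W → shadow a r ∉ Zs
  ∉-Zs-shadow {a} {r} a<W r<W s∈ with ∈-Zs⁻ s∈
  ... | inj₁ s∈zs = shadow≢ a r (All.lookup zs<W s∈zs) refl
  ... | inj₂ s∈cv with ∈-map⁻ countVar s∈cv
  ...   | r' , r'∈ , s≡ = ℕP.<-irrefl (proj₁ (shadow-injective r<W (proj₁ (∈-indices⁻ r'∈)) s≡)) a<W

  Zs-unique : Unique Zs
  Zs-unique = subst Unique (sym Zs≡) (UniqueP.++⁺ zs-unique (UniqueP.map⁺ countVar-injective indices-unique)
                (λ (y∈zs , y∈cv) → <W⇒∉countVars (All.lookup zs<W y∈zs) y∈cv))

  α'-arith : Arith α'
  α'-arith = Arith-elim x<W α bα oα , Pure.arith (Pure-consistencyᶠ x<W)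

  cs'-readsAt : All (ReadsAt x ∘ proj₁) cs'
  cs'-readsAt = AllP.++⁺ (AllP.map⁺ (All.map (λ {(β , _)} (bβ , oβ) → ReadsAt-elim x<W β bβ oβ) bcs))
                         (AllP.map⁺ (All.universal (ReadsAt-readsᶠ x<W) indices))

  ψ-target : TargetForm ψ
  ψ-target = x , α' , cs' , refl , Zs-unique , ∉-Zs-low x<W x∉zs , α'-arith ,
             (NotOcc-elim x<W α bα oα , Pure.not-occ (Pure-consistencyᶠ x<W)) , cs'-readsAt

  Sem-χ : ∀ {M σ} → Sem M σ χ ⇔
          (Sem M σ α' × All (Sem M σ ∘ cardEq x ∘ elimCard) cs × All (Sem M σ ∘ cardEq x ∘ countCard) indices)
  Sem-χ = ⇔-trans (Sem-conjs α' (map (cardEq x) cs'))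
            (⇔-refl ×-⇔ ⇔-trans (All-map-⇔ cs')
                          (⇔-trans (All-++-⇔ (map elimCard cs)) (All-map-⇔ cs ×-⇔ All-map-⇔ indices)))

  Sem-body-elim : ∀ {M σ} → ShadowsMatch M [] σ →
                  Sem M σ body ⇔ (Sem M σ (elim α) × All (Sem M σ ∘ cardEq x ∘ elimCard) cs)
  Sem-body-elim {M} {σ} match =
    ⇔-trans (Sem-conjs α (map (cardEq x) cs)) (Sem-elim α nα bα match ×-⇔ ⇔-trans (All-map-⇔ cs) (All-⇔ cards))
    where
    cards : All (λ c → Sem M σ (cardEq x c) ⇔ Sem M σ (cardEq x (elimCard c))) cs
    cards = All.zipWith (λ {(β , z)} ((bβ , _) , ((_ , nβ) , _)) →
              ⇔-trans Sem-cardEq (⇔-trans (IsCard-⇔ λ i _ → Sem-elim β nβ bβ (ShadowsMatch-index {M} i x<W match))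
                                          (⇔-sym Sem-cardEq)))
              (bcs , ncs)

  module Forward (M : Model) (ρ ρ' : Env) (sbody : Sem M ρ' body) (agree : ∀ y → y ∉ zs → ρ' y ≡ ρ y) where
    SameReads : Var → ℤ → Set
    SameReads r i = ∀ a → a <ℕ W → arr M a i ≡ arr M a (ρ' r)

    counted : ∀ r → Σ ℤ (IsCard (N M) (SameReads r))
    counted r = IsCard-exists (λ i → dec-arrays (λ a → arr M a i ℤP.≟ arr M a (ρ' r))) (N M)

    decode : ArrayId → Var → ℤ
    decode a r with a ℕ.<? W
    ... | yes _ = arr M a (ρ' r)
    ... | no _ = proj₁ (counted r)

    -- Below W the given valuation; above W, the intended values of shadow and count variables.
    lowHigh : Env → Env
    lowHigh σ n with n ℕ.<? W
    ... | yes _ = σ n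
    ... | no _ = decode (n / W ∸ 1) (n % W)

    ρ'' : Env
    ρ'' = override (lowHigh ρ) Zs (lowHigh ρ')

    lowHigh-low : ∀ σ {y} → y <ℕ W → lowHigh σ y ≡ σ y
    lowHigh-low σ {y} y<W with y ℕ.<? W
    ... | yes _ = refl
    ... | no y≮W = ⊥-elim (y≮W y<W)

    lowHigh-shadow : ∀ σ a r → r <ℕ W → lowHigh σ (shadow a r) ≡ decode a r
    lowHigh-shadow σ a r r<W with shadow a r ℕ.<? W
    ... | yes s<W = ⊥-elim (ℕP.<⇒≱ s<W (W≤shadow a r))
    ... | no _ = cong₂ decode (cong (_∸ 1) (shadow/W a r r<W)) (shadow%W a r r<W)

    ρ''-low : ∀ {y} → y <ℕ W → ρ'' y ≡ ρ' y
    ρ''-low {y} y<W with y ∈ℕ? Zs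
    ... | yes y∈ = trans (override-∈ _ Zs _ y∈) (lowHigh-low ρ' y<W)
    ... | no y∉ = trans (override-∉ _ Zs _ y∉) (trans (lowHigh-low ρ y<W) (sym (agree y (y∉ ∘ ∈-zs⇒∈-Zs))))

    ρ''-shadow : ∀ {a r} → a <ℕ W → r <ℕ W → ρ'' (shadow a r) ≡ arr M a (ρ' r)
    ρ''-shadow {a} {r} a<W r<W =
      trans (override-∉ _ Zs _ (∉-Zs-shadow a<W r<W)) (trans (lowHigh-shadow ρ a r r<W) decode-array)
      where
      decode-array : decode a r ≡ arr M a (ρ' r)
      decode-array with a ℕ.<? W
      ... | yes _ = refl
      ... | no a≮W = ⊥-elim (a≮W a<W)

    ρ''-count : ∀ {r} → r ∈ indices → ρ'' (countVar r) ≡ proj₁ (counted r)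
    ρ''-count {r} r∈ = trans (override-∈ _ Zs _ (∈-Zs-countVar r∈))
                             (trans (lowHigh-shadow ρ' W r (proj₁ (∈-indices⁻ r∈))) decode-count)
      where
      decode-count : decode W r ≡ proj₁ (counted r)
      decode-count with W ℕ.<? W
      ... | yes W<W = ⊥-elim (ℕP.<-irrefl refl W<W)
      ... | no _ = refl

    ρ''-reads : ∀ {a r} → a <ℕ W → r <ℕ W → ρ'' (shadow a r) ≡ arr M a (ρ'' r)
    ρ''-reads {a} a<W r<W = trans (ρ''-shadow a<W r<W) (cong (arr M a) (sym (ρ''-low r<W)))

    match : ShadowsMatch M [] ρ''
    match a r a<W r<W _ _ = ρ''-reads a<W r<W

    hall-bound : ∀ {h t} → h ∈ indices → t ⊑ indices → HallPremise {M} {ρ''} h t → + length t < ρ'' (countVar h)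
    hall-bound {h} {t} h∈ t⊑ (h-in , t-in , distinct , t-eq) =
      subst (+ length t <_) (sym (ρ''-count h∈))
        (ℤP.<-≤-trans (+<+ ℕP.≤-refl)
          (subst (λ n → + n ≤ proj₁ (counted h)) (cong suc (length-map ρ'' t))
            (length≤IsCard (map ρ'' (h ∷ t)) (proj₂ (counted h)) distinct
              ((h-in , λ a _ → cong (arr M a) (ρ''-low h<W)) ∷
               AllP.map⁺ (All.tabulate λ r∈ → All.lookup t-in r∈ , same-reads r∈)))))
      where
      h<W = proj₁ (∈-indices⁻ h∈)
      same-reads : ∀ {r} → r ∈ t → SameReads h (ρ'' r)
      same-reads {r} r∈ a a<W = begin
        arr M a (ρ'' r)     ≡⟨ ρ''-reads a<W r<W ⟨
        ρ'' (shadow a r)    ≡⟨ All.lookup t-eq r∈ a a<W ⟩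
        ρ'' (shadow a h)    ≡⟨ ρ''-shadow a<W h<W ⟩
        arr M a (ρ' h)      ∎
        where
        open ≡-Reasoning
        r<W = proj₁ (∈-indices⁻ (⊑-lookup t⊑ r∈))

    consistent : Consistent {M} {ρ''}
    consistent = record
      { outside-zero = All.tabulate λ {r} r∈ r-out a a<W →
          trans (ρ''-reads a<W (index<W r∈)) (arr-zero M a (ρ'' r) r-out)
      ; functional = All.tabulate λ {r} r∈ → All.tabulate λ {r'} r'∈ ρr≡ρr' a a<W →
          trans (ρ''-reads a<W (index<W r∈))
                (trans (cong (arr M a) ρr≡ρr') (sym (ρ''-reads a<W (index<W r'∈))))
      ; hall = All.tabulate λ h∈ → All.tabulate λ t∈ → hall-bound h∈ (∈-subsequences⁻ indices t∈) }
      where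
      index<W : ∀ {r} → r ∈ indices → r <ℕ W
      index<W = proj₁ ∘ ∈-indices⁻

    count-cards : All (Sem M ρ'' ∘ cardEq x ∘ countCard) indices
    count-cards = All.tabulate λ {r} r∈ → proj₂ Sem-cardEq
      (subst (IsCard (N M) _) (sym (ρ''-count r∈))
        (IsCard-cong (λ i _ same → proj₂ (Sem-readsᶠ x<W r) λ a a<W → trans (same a a<W) (sym (ρ''-shadow a<W (r<W r∈))))
                     (λ i _ s a a<W → trans (proj₁ (Sem-readsᶠ x<W r) s a a<W) (ρ''-shadow a<W (r<W r∈)))
                     (proj₂ (counted r))))
      where
      r<W : ∀ {r} → r ∈ indices → r <ℕ W
      r<W = proj₁ ∘ ∈-indices⁻

    sat-ψ : Sat ψ
    sat-ψ = M , lowHigh ρ , exs-intro (lowHigh ρ) Zs (lowHigh ρ') χ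
      (proj₂ Sem-χ ((proj₁ elim-parts , proj₂ Sem-consistencyᶠ consistent) , proj₂ elim-parts , count-cards))
      where
      elim-parts = proj₁ (Sem-body-elim match) (Sem-agree body nbody (λ y y<W → sym (ρ''-low y<W)) sbody)

  module Backward (M₀ : Model) (ρ ρ' : Env) (sχ : Sem M₀ ρ' χ) (agree : ∀ y → y ∉ Zs → ρ' y ≡ ρ y) where
    Placed : Model → ℤ → Var → Set
    Placed M i r = ∀ a → a <ℕ W → arr M a i ≡ ρ' (shadow a r)

    -- After processing L by transpositions, the indices D ⊑ L sit at positions carrying their own
    -- shadows, and every other in-range index of L shares its position with one of them.
    record Arranged (L : List Var) (M : Model) (D : List Var) : Set where
      field
        sat : Sem M ρ' χ
        D⊑L : D ⊑ L
        distinct : Unique (map ρ' D)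
        in-range : All (InRange (N M) ∘ ρ') D
        placed : All (λ d → Placed M (ρ' d) d) D
        covered : All (λ r → ¬ InRange (N M) (ρ' r) ⊎ ρ' r ∈ map ρ' D) L

      consistent : Consistent {M} {ρ'}
      consistent = proj₁ Sem-consistencyᶠ (proj₂ (proj₁ (proj₁ Sem-χ sat)))

    Arrangement : List Var → Set
    Arrangement L = Σ Model λ M → Σ (List Var) (Arranged L M)

    skip : ∀ {r L M D} → Arranged L M D → ¬ InRange (N M) (ρ' r) ⊎ ρ' r ∈ map ρ' D → Arranged (r ∷ L) M D
    skip arranged r-covered = record
      { sat = sat ; D⊑L = _ ∷ʳ D⊑L ; distinct = distinct ; in-range = in-range ; placed = placed
      ; covered = r-covered ∷ covered }
      where open Arranged arranged

    -- Hall's condition for r leaves more positions carrying r's shadow values than the placed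
    -- indices with the same shadow values can occupy.
    free-position : ∀ {r L M D} → r ∷ L ⊑ indices → Arranged L M D → InRange (N M) (ρ' r) → ρ' r ∉ map ρ' D →
                    ∃ λ q → InRange (N M) q × Placed M q r × q ∉ map ρ' D
    free-position {r} {L} {M} {D} r∷L⊑ arranged r-in r∉D
      with IsCard-∃∉ (map ρ' t) count (subst (λ n → + n < ρ' (countVar r)) (sym (length-map ρ' t)) hall-r)
      where
      open Arranged arranged
      r∈ : r ∈ indices
      r∈ = ⊑-lookup r∷L⊑ (here refl)
      t : List Var
      t = filter (λ d → dec-arrays (λ a → ρ' (shadow a d) ℤP.≟ ρ' (shadow a r))) D
      t⊑D : t ⊑ D
      t⊑D = filter-⊆ _ D
      premise : HallPremise {M} {ρ'} r t
      premise = r-in , AllP.anti-mono (⊑-lookup t⊑D) in-range ,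
                (All.tabulate (λ y∈ ρr≡y → r∉D (subst (_∈ map ρ' D) (sym ρr≡y) (⊑-lookup (⊑-map⁺ ρ' t⊑D) y∈)))
                  ∷ AllPairs-anti-mono (⊑-map⁺ ρ' t⊑D) distinct) ,
                AllP.all-filter _ D
      hall-r : + length t < ρ' (countVar r)
      hall-r = All.lookup (All.lookup (Consistent.hall consistent) r∈)
                 (∈-subsequences⁺ (⊆-trans t⊑D (⊆-trans D⊑L (⊆-trans (r ∷ʳ ⊆-refl) r∷L⊑)))) premise
      count : IsCard (N M) (λ i → Sem M (ρ' [ x ↦ i ]) (readsᶠ r)) (ρ' (countVar r))
      count = proj₁ Sem-cardEq (All.lookup (proj₂ (proj₂ (proj₁ Sem-χ sat))) r∈)
    ... | q , q-in , q-reads , q∉t = q , q-in , q-placed , q∉D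
      where
      open Arranged arranged
      q-placed : Placed M q r
      q-placed = proj₁ (Sem-readsᶠ x<W r) q-reads
      q∉D : q ∉ map ρ' D
      q∉D q∈D with ∈-map⁻ ρ' q∈D
      ... | d , d∈D , refl =
        q∉t (∈-map⁺ ρ' (∈-filter⁺ (λ d → dec-arrays (λ a → ρ' (shadow a d) ℤP.≟ ρ' (shadow a r))) d∈D
               (λ a a<W → trans (sym (All.lookup placed d∈D a a<W)) (q-placed a a<W))))

    swap-into : ∀ {r L M D} → Arranged L M D → InRange (N M) (ρ' r) → ρ' r ∉ map ρ' D →
                (∃ λ q → InRange (N M) q × Placed M q r × q ∉ map ρ' D) → Arrangement (r ∷ L)
    swap-into {r} {L} {M} {D} arranged r-in r∉D (q , q-in , q-placed , q∉D) = permute M π , r ∷ D , record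
      { sat = proj₁ (SameTruth-flatBody M π x α' cs' α'-arith cs'-readsAt ρ') sat
      ; D⊑L = refl ∷ D⊑L
      ; distinct = All.tabulate (λ ρd∈ ρr≡ρd → r∉D (subst (_∈ map ρ' D) (sym ρr≡ρd) ρd∈)) ∷ distinct
      ; in-range = r-in ∷ in-range
      ; placed = placed-r ∷ All.tabulate placed-D
      ; covered = inj₂ (here refl) ∷ All.map (λ { (inj₁ out) → inj₁ out ; (inj₂ ρr∈) → inj₂ (there ρr∈) }) covered
      }
      where
      open Arranged arranged
      open Transposition (N M) (ρ' r) q r-in q-in
      π : Perm (N M)
      π = transposition
      placed-r : Placed (permute M π) (ρ' r) r
      placed-r a a<W = trans (permArr-inRange (N M) π (arr M) a (ρ' r) r-in) (trans (cong (arr M a) swap-p) (q-placed a a<W))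
      placed-D : ∀ {d} → d ∈ D → Placed (permute M π) (ρ' d) d
      placed-D {d} d∈ a a<W =
        trans (permArr-inRange (N M) π (arr M) a (ρ' d) (All.lookup in-range d∈))
              (trans (cong (arr M a) (swap-other (r∉D ∘ ρd∈D) (q∉D ∘ ρd∈D))) (All.lookup placed d∈ a a<W))
        where
        ρd∈D : ∀ {i} → ρ' d ≡ i → i ∈ map ρ' D
        ρd∈D refl = ∈-map⁺ ρ' d∈

    extend : ∀ {r L} → r ∷ L ⊑ indices → Arrangement L → Arrangement (r ∷ L)
    extend {r} r∷L⊑ (M , D , arranged) with inRange? (N M) (ρ' r)
    ... | no r-out = M , D , skip arranged (inj₁ r-out)
    ... | yes r-in with ρ' r ∈ℤ? map ρ' D
    ...   | yes ρr∈ = M , D , skip arranged (inj₂ ρr∈)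
    ...   | no r∉D = swap-into arranged r-in r∉D (free-position r∷L⊑ arranged r-in r∉D)

    arrangement : ∀ L → L ⊑ indices → Arrangement L
    arrangement [] _ = M₀ , [] , record
      { sat = sχ ; D⊑L = [] ; distinct = [] ; in-range = [] ; placed = [] ; covered = [] }
    arrangement (r ∷ L) r∷L⊑ = extend r∷L⊑ (arrangement L (⊆-trans (r ∷ʳ ⊆-refl) r∷L⊑))

    arranged-match : ∀ {M D} → Arranged indices M D → ShadowsMatch M [] ρ'
    arranged-match {M} {D} arranged a r a<W r<W r≢x _ = reads (All.lookup covered r∈)
      where
      open Arranged arranged
      r∈ = ∈-indices⁺ r<W r≢x
      reads : ¬ InRange (N M) (ρ' r) ⊎ ρ' r ∈ map ρ' D → ρ' (shadow a r) ≡ arr M a (ρ' r)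
      reads (inj₁ r-out) =
        trans (All.lookup (Consistent.outside-zero consistent) r∈ r-out a a<W) (sym (arr-zero M a (ρ' r) r-out))
      reads (inj₂ ρr∈) with ∈-map⁻ ρ' ρr∈
      ... | d , d∈D , ρr≡ρd = begin
        ρ' (shadow a r)      ≡⟨ All.lookup (All.lookup (Consistent.functional consistent) r∈) d∈ ρr≡ρd a a<W ⟩
        ρ' (shadow a d)      ≡⟨ All.lookup placed d∈D a a<W ⟨
        arr M a (ρ' d)       ≡⟨ cong (arr M a) ρr≡ρd ⟨
        arr M a (ρ' r)       ∎
        where
        open ≡-Reasoning
        d∈ = ⊑-lookup D⊑L d∈D

    sat-φ : Sat φ
    sat-φ with arrangement indices ⊆-refl
    ... | M , D , arranged = M , ρ , exs-intro ρ zs ρ' body (Sem-agree body nbody agree-low sbody)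
      where
      open Arranged arranged
      parts = proj₁ Sem-χ sat
      sbody : Sem M ρ' body
      sbody = proj₂ (Sem-body-elim (arranged-match arranged)) (proj₁ (proj₁ parts) , proj₁ (proj₂ parts))
      agree-low : AgreeBelow W ρ' (override ρ zs ρ')
      agree-low y y<W with y ∈ℕ? zs
      ... | yes y∈ = sym (override-∈ ρ zs ρ' y∈)
      ... | no y∉ = trans (agree y (∉-Zs-low y<W y∉)) (sym (override-∉ ρ zs ρ' y∉))

  equisatisfiable : Sat φ ⇔ Sat ψ
  equisatisfiable =
    (λ (M , ρ , s) → let (ρ' , sbody , agree) = exs-elim ρ zs body s in Forward.sat-ψ M ρ ρ' sbody agree) ,
    (λ (M , ρ , s) → let (ρ' , sχ , agree) = exs-elim ρ Zs χ s in Backward.sat-φ M ρ ρ' sχ agree)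

Sat-⋁-singleton⁺ : ∀ ψ → Sat ψ → Sat (⋁ (ψ ∷ []))
Sat-⋁-singleton⁺ ψ (M , ρ , s) = M , ρ , λ (¬s , _) → ¬s s

Sat-⋁-singleton⁻ : ∀ ψ → Sat (⋁ (ψ ∷ [])) → ¬ ¬ Sat ψ
Sat-⋁-singleton⁻ ψ (M , ρ , s) ¬sat =
  s ((λ sψ → ¬sat (M , ρ , sψ)) , λ { (_ , _ , refl , refl , 0<0) → ℤP.<-irrefl refl 0<0 })

lemma2 : (φ : Form) → SimpleEFlat φ →
    Σ (List Form) λ ψs →
      All (λ ψ → TargetForm ψ × PermInvariant ψ) ψs × Equisat φ (⋁ ψs)
lemma2 φ (x , α , cs , refl , zs-unique , x∉zs , bα , oα , bcs) =
  ψ ∷ [] , (ψ-target , TargetForm⇒PermInvariant ψ ψ-target) ∷ [] ,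
  (λ ¬¬φ ¬ψ → ¬¬φ (¬ψ ∘ Sat-⋁-singleton⁺ ψ ∘ proj₁ equisatisfiable)) ,
  (λ ¬¬ψ ¬φ → ¬¬ψ (λ sat → Sat-⋁-singleton⁻ ψ sat (¬φ ∘ proj₂ equisatisfiable)))
  where open Reduction x α cs zs-unique x∉zs bα oα bcs
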